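{- Let $\varepsilon > 0$, let $P(x,y,z)=(x-y)^k+z$, where $k\geq2$ is an integer, and let $q$ be a power of a prime $p > k$. Let $X,Y,Z\subseteq\mathbb{F}_q$ be such that $|X|,|Y|,|Z|\gg q^{8/9+\varepsilon}$. Then $$|P(X,Y,Z)|=q-O_{\varepsilon,k}(q^{1-3\varepsilon}).$$
   Context: For $X,Y,Z \subseteq \mathbb{F}_q$, $P(X,Y,Z) := \{P(x,y,z) : x\in X, y \in Y, z \in Z\}$. The hypothesis $|X|,|Y|,|Z| \gg q^{8/9+\varepsilon}$ means that $|X|,|Y|,|Z| \ge c\, q^{8/9+\varepsilon}$ for some fixed constant $c>0$. The notation $A = q - O_{\varepsilon,k}(E)$ means $|A-q| \le C E$ for some constant $C>0$ depending only on $\varepsilon$, $k$ (and the implied constant $c$ in the hypothesis), but not on $q$, $X$, $Y$, $Z$. -}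

module Defs where

open import Algebra.Apartness.Bundles using (HeytingField; HeytingCommutativeRing)
open import Algebra.Bundles using (CommutativeRing)
import Algebra.Properties.Group as GroupProperties
import Algebra.Properties.Semiring.Exp as Exp
open import Data.Empty using (⊥)
open import Data.Fin.Base using (Fin)
import Data.Fin.Properties as Fin
open import Data.Fin.Subset using (Subset; _∈_)
open import Data.Fin.Subset.Properties using (_∈?_)
open import Data.Integer.Base as ℤ using (ℤ; -[1+_])
open import Data.Nat.Base as ℕ using (ℕ)
open import Data.Product.Base using (∃; ∃-syntax; _×_; _,_)
open import Data.Rational.Base
open import Data.Rational.Properties hiding (≡-setoid; heytingField)
open import Data.Sum.Base using (_⊎_; inj₁; inj₂; swap)
open import Data.Vec.Base using (tabulate)
open import Function.Bundles using (Inverse)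
open import Level using (Level; 0ℓ)
open import Relation.Binary.PropositionalEquality
  using (_≡_; refl; sym; trans; cong; subst; subst₂) renaming (setoid to ≡-setoid)
open import Relation.Nullary.Decidable using (Dec; does; _×-dec_)
open import Relation.Unary using (Pred)

------------------------------------------------------------------------
-- Real numbers, as two-sided Dedekind cuts of ℚ:
-- lower r  means  r < x,  and  upper r  means  x < r.

record ℝ : Set₁ where
  field
    lower upper     : Pred ℚ 0ℓ
    lower-inhabited : ∃ lower
    upper-inhabited : ∃ upper
    lower-closed    : ∀ {r s} → r < s → lower s → lower r
    upper-closed    : ∀ {r s} → r < s → upper r → upper s
    lower-open      : ∀ {r} → lower r → ∃[ s ] r < s × lower s
    upper-open      : ∀ {s} → upper s → ∃[ r ] r < s × upper r
    disjoint        : ∀ {r} → lower r → upper r → ⊥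
    located         : ∀ {r s} → r < s → lower r ⊎ upper s

open ℝ public

0<_ : ℝ → Set
0< x = lower x 0ℚ

private
  neg-involutive : ∀ r → - (- r) ≡ r
  neg-involutive = GroupProperties.⁻¹-involutive +-0-group

  neg-flip : ∀ {r s} → r < - s → s < - r
  neg-flip {r} {s} r<-s = subst (_< - r) (neg-involutive s) (neg-antimono-< r<-s)

  neg-flip′ : ∀ {r s} → - r < s → - s < r
  neg-flip′ {r} {s} -r<s = subst (- s <_) (neg-involutive r) (neg-antimono-< -r<s)

  -- An increasing bijection g of ℚ with inverse h sends x to the real whose
  -- cuts are the preimages, under h, of those of x.
  transport : (g h : ℚ → ℚ) → (∀ {r s} → r < s → g r < g s) →
              (∀ {r s} → r < s → h r < h s) →
              (∀ r → g (h r) ≡ r) → (∀ r → h (g r) ≡ r) → ℝ → ℝ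
  transport g h g-mono h-mono gh hg x = record
    { lower           = λ r → lower x (h r)
    ; upper           = λ r → upper x (h r)
    ; lower-inhabited = let r , p = lower-inhabited x in g r , subst (lower x) (sym (hg r)) p
    ; upper-inhabited = let r , p = upper-inhabited x in g r , subst (upper x) (sym (hg r)) p
    ; lower-closed    = λ r<s → lower-closed x (h-mono r<s)
    ; upper-closed    = λ r<s → upper-closed x (h-mono r<s)
    ; lower-open      = λ {r} p → let s , hr<s , q = lower-open x p in
                        g s , subst (_< g s) (gh r) (g-mono hr<s)
                            , subst (lower x) (sym (hg s)) q
    ; upper-open      = λ {s} p → let r , r<hs , q = upper-open x p in
                        g r , subst (g r <_) (gh s) (g-mono r<hs)
                            , subst (upper x) (sym (hg r)) q
    ; disjoint        = disjoint x
    ; located         = λ r<s → located x (h-mono r<s)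
    }

infixr 6 _⊕_
infixr 7 _⊙_
infix  8 ⊖_

-- a ⊕ x is the sum of the rational a and the real x.
_⊕_ : ℚ → ℝ → ℝ
a ⊕ x = transport (a +_) (- a +_) (+-monoʳ-< a) (+-monoʳ-< (- a)) inv₁ inv₂ x
  where
  inv₁ : ∀ r → a + (- a + r) ≡ r
  inv₁ r = trans (sym (+-assoc a (- a) r))
                 (trans (cong (_+ r) (+-inverseʳ a)) (+-identityˡ r))
  inv₂ : ∀ r → - a + (a + r) ≡ r
  inv₂ r = trans (sym (+-assoc (- a) a r))
                 (trans (cong (_+ r) (+-inverseˡ a)) (+-identityˡ r))

-- a ⊙ x is the product of the positive rational a and the real x.
_⊙_ : (a : ℚ) .{{_ : Positive a}} → ℝ → ℝ
a ⊙ x = transport (a *_) (a⁻¹ *_) (*-monoʳ-<-pos a) (*-monoʳ-<-pos a⁻¹ {{1/pos⇒pos a}}) inv₁ inv₂ x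
  where
  instance
    a≢0 : NonZero a
    a≢0 = pos⇒nonZero a
  a⁻¹ : ℚ
  a⁻¹ = 1/ a
  inv₁ : ∀ r → a * (a⁻¹ * r) ≡ r
  inv₁ r = trans (sym (*-assoc a a⁻¹ r))
                 (trans (cong (_* r) (*-inverseʳ a)) (*-identityˡ r))
  inv₂ : ∀ r → a⁻¹ * (a * r) ≡ r
  inv₂ r = trans (sym (*-assoc a⁻¹ a r))
                 (trans (cong (_* r) (*-inverseˡ a)) (*-identityˡ r))

⊖_ : ℝ → ℝ
⊖ x = record
  { lower           = λ r → upper x (- r)
  ; upper           = λ r → lower x (- r)
  ; lower-inhabited = let r , p = upper-inhabited x in - r , subst (upper x) (sym (neg-involutive r)) p
  ; upper-inhabited = let r , p = lower-inhabited x in - r , subst (lower x) (sym (neg-involutive r)) p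
  ; lower-closed    = λ r<s → upper-closed x (neg-antimono-< r<s)
  ; upper-closed    = λ r<s → lower-closed x (neg-antimono-< r<s)
  ; lower-open      = λ p → let s , s<-r , q = upper-open x p in
                      - s , neg-flip s<-r , subst (upper x) (sym (neg-involutive s)) q
  ; upper-open      = λ p → let r , -s<r , q = lower-open x p in
                      - r , neg-flip′ -s<r , subst (lower x) (sym (neg-involutive r)) q
  ; disjoint        = λ p q → disjoint x q p
  ; located         = λ r<s → swap (located x (neg-antimono-< r<s))
  }

------------------------------------------------------------------------
-- Comparison of a natural number n with c · q^x.

fromℕ : ℕ → ℚ
fromℕ n = ℤ.+ n / 1

open Exp (CommutativeRing.semiring +-*-commutativeRing) public
  using () renaming (_^_ to _^ℚ_)

infix 10 _⁺ _⁻

-- i = i ⁺ - i ⁻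
_⁺ _⁻ : ℤ → ℕ
(ℤ.+ n) ⁺  = n
-[1+ n ] ⁺ = 0
i ⁻        = (ℤ.- i) ⁺

-- Rational exponent s = a/b with b > 0, and rational r > 0, q ≥ 1: raising to
-- the b-th power and clearing the negative part of a, the inequality
-- r · q^s ≤ n  reads  r^b · q^(a ⁺) ≤ n^b · q^(a ⁻).
[_·_^_]≤ℚ_ : ℚ → ℕ → ℚ → ℕ → Set
[ r · q ^ s ]≤ℚ n =
  (r ^ℚ ↧ₙ s) * fromℕ (q ℕ.^ (↥ s) ⁺) ≤ fromℕ (n ℕ.^ ↧ₙ s ℕ.* q ℕ.^ (↥ s) ⁻)

_≤ℚ[_·_^_] : ℕ → ℚ → ℕ → ℚ → Set
n ≤ℚ[ r · q ^ s ] =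
  fromℕ (n ℕ.^ ↧ₙ s ℕ.* q ℕ.^ (↥ s) ⁻) ≤ (r ^ℚ ↧ₙ s) * fromℕ (q ℕ.^ (↥ s) ⁺)

-- Real c > 0 and real exponent x, for q ≥ 1: as (r , s) ↦ r · q^s is
-- continuous and nondecreasing in r > 0 and in s, c · q^x is the supremum of
-- its values at rationals 0 < r < c, s < x and the infimum of its values at
-- rationals r > c, s > x.
[_·_^_]≤_ : ℝ → ℕ → ℝ → ℕ → Set
[ c · q ^ x ]≤ n =
  ∀ r s → 0ℚ < r → lower c r → lower x s → [ r · q ^ s ]≤ℚ n

_≤[_·_^_] : ℕ → ℝ → ℕ → ℝ → Set
n ≤[ c · q ^ x ] =
  ∀ r s → 0ℚ < r → upper c r → upper x s → n ≤ℚ[ r · q ^ s ]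

------------------------------------------------------------------------
-- Finite fields.  A Heyting field whose carrier is in bijection with Fin q is
-- a field with q elements in the usual sense: on such a carrier _≈_ is
-- decidable, and _#_ is its negation.

record FiniteField (a ℓ₁ ℓ₂ : Level) (q : ℕ) : Set (Level.suc (a Level.⊔ ℓ₁ Level.⊔ ℓ₂)) where
  field
    heytingField : HeytingField a ℓ₁ ℓ₂

  commutativeRing : CommutativeRing a ℓ₁
  commutativeRing = HeytingCommutativeRing.commutativeRing
                      (HeytingField.heytingCommutativeRing heytingField)

  open CommutativeRing commutativeRing public
    using (Carrier; setoid; semiring)
    renaming (_+_ to _+F_; _-_ to _-F_)

  open Exp semiring public using () renaming (_^_ to _^F_)

  field
    enumeration : Inverse (≡-setoid (Fin q)) setoid

  element : Fin q → Carrier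
  element = Inverse.to enumeration

  index : Carrier → Fin q
  index = Inverse.from enumeration

  -- Subsets of the field are given by the indices of their elements.
  SubsetF : Set
  SubsetF = Subset q

  IsValue : (Carrier → Carrier → Carrier → Carrier) →
            SubsetF → SubsetF → SubsetF → Fin q → Set
  IsValue f X Y Z w =
    ∃[ x ] ∃[ y ] ∃[ z ]
      x ∈ X × y ∈ Y × z ∈ Z × w ≡ index (f (element x) (element y) (element z))

  isValue? : ∀ f X Y Z w → Dec (IsValue f X Y Z w)
  isValue? f X Y Z w =
    Fin.any? λ x → Fin.any? λ y → Fin.any? λ z →
      (x ∈? X) ×-dec (y ∈? Y) ×-dec (z ∈? Z)
        ×-dec (w Fin.≟ index (f (element x) (element y) (element z)))

  -- image f X Y Z = { f x y z : x ∈ X, y ∈ Y, z ∈ Z }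
  image : (Carrier → Carrier → Carrier → Carrier) →
          SubsetF → SubsetF → SubsetF → SubsetF
  image f X Y Z = tabulate λ w → does (isValue? f X Y Z w)

  P : ℕ → Carrier → Carrier → Carrier → Carrier
  P k x y z = ((x -F y) ^F k) +F z

module Submission where

-- Let W be the complement of the image, f the indicator function of X, and
-- h = q 1_Z - |Z|.  For y ∈ Y and w ∈ W the sum G y w = Σ_x f x h (w - (x - y)^k)
-- equals -|X||Z|, hence |Y||W|(|X||Z|)² ≤ S, where S = Σ_{y,w} (G y w)².  Let N be
-- the autocorrelation of h.  Expanding the square and substituting
-- y = x - (x - x′) v gives S = Σ_v D (v^k - (v - 1)^k), where
-- D s = Σ_{x,x′} f x f x′ N ((x - x′)^k s).  For k < p the polynomial
-- v^k - (v - 1)^k takes no value more than k times, so S² ≤ q k Σ_s (D s)² by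
-- Cauchy–Schwarz.  The right-hand side is a combination of the numbers
-- V t u = Σ_s N (t s) N (u s); they are nonnegative, and their sum over u is
-- q N(0)².  This yields (|X||Y||Z||W|)² ≤ k² q⁷ without character sums; the
-- exponent 22/3 in place of 7 would suffice for the theorem.

-- The factor q in h keeps all weights integral, and subtracting |Z| gives h mean zero; the zero
-- mean is the source of the saving, since it removes every term except s = 0 from the sum of the V
-- t u. The substitution for y is chosen so that x - y = (x - x′) v and x′ - y = (x - x′)(v - 1): by
-- homogeneity the pair enters only through (x - x′)^k, so that all pairs share one polynomial in v
-- and can be gathered in the single function D. Replacing values of a polynomial by a free variable
-- costs only a bound on the fibres, provided that the summand is nonnegative. It happens twice: D
-- is squared first to make it possible, and V has to be shown to be a sum of squares, which takes
-- the place of positivity on the Fourier side. The leading coefficient of v^k - (v - 1)^k is k, and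
-- k < p keeps it from vanishing; for k = p the polynomial is the constant 1, and no such fibre
-- bound holds. Roots are avoided at the end: each comparison with a power of q of rational exponent
-- is raised to a power that clears the denominators.

open import Algebra.Bundles using (CommutativeRing)

-- Identities in a commutative ring, decided with integer coefficients.

module IntegerCoefficients {c ℓ} (R : CommutativeRing c ℓ) where
  open import Data.Nat.Base as ℕ using (ℕ; zero; suc)
  import Data.Nat.Properties as ℕ
  open import Data.Integer.Base as ℤ using (ℤ; +_; -[1+_]; _⊖_)
  import Data.Integer.Properties as ℤ
  open import Data.Maybe.Base using (Maybe; map)
  open import Relation.Nullary.Decidable.Core using (dec⇒maybe)
  import Relation.Binary.PropositionalEquality as ≡
  open import Algebra.Solver.Ring.AlmostCommutativeRing using (fromCommutativeRing; _-Raw-AlmostCommutative⟶_)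
  import Algebra.Solver.Ring as RingSolver
  open CommutativeRing R
  open import Algebra.Properties.Ring ring
  open import Algebra.Properties.AbelianGroup +-abelianGroup using (⁻¹-∙-comm)
  open import Algebra.Properties.Semiring.Mult.TCOptimised semiring
  open import Relation.Binary.Reasoning.Setoid setoid

  -- The canonical map from the integers. Integer coefficients compute and have decidable equality,
  -- so terms can be cancelled over a ring whose own operations are opaque. With this version of
  -- `×`, `⟦ + 1 ⟧` is `1#` by definition, so `con (+ 1)` can stand for the unit.
  ⟦_⟧ : ℤ → Carrier
  ⟦ + n ⟧      = n × 1#
  ⟦ -[1+ n ] ⟧ = - (suc n × 1#)

  ⟦⟧-neg : ∀ i → ⟦ ℤ.- i ⟧ ≈ - ⟦ i ⟧
  ⟦⟧-neg (+ zero)   = sym -0#≈0#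
  ⟦⟧-neg (+ suc n)  = refl
  ⟦⟧-neg -[1+ n ]   = sym (-‿involutive _)

  private
    ×-suc : ∀ n → suc n × 1# ≈ 1# + n × 1#
    ×-suc n = ×-homo-+ 1# 1 n

  ⟦⟧-⊖ : ∀ m n → ⟦ m ⊖ n ⟧ ≈ m × 1# - n × 1#
  ⟦⟧-⊖ m       zero    = sym (trans (+-congˡ -0#≈0#) (+-identityʳ _))
  ⟦⟧-⊖ zero    (suc n) = sym (+-identityˡ _)
  ⟦⟧-⊖ (suc m) (suc n) = begin
    ⟦ suc m ⊖ suc n ⟧                     ≡⟨ ≡.cong ⟦_⟧ (ℤ.[1+m]⊖[1+n]≡m⊖n m n) ⟩
    ⟦ m ⊖ n ⟧                             ≈⟨ ⟦⟧-⊖ m n ⟩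
    m × 1# - n × 1#                       ≈⟨ +-congʳ (+-identityˡ _) ⟨
    (0# + m × 1#) - n × 1#                ≈⟨ +-congʳ (+-congʳ (-‿inverseˡ 1#)) ⟨
    ((- 1# + 1#) + m × 1#) - n × 1#       ≈⟨ +-congʳ (+-assoc _ _ _) ⟩
    (- 1# + (1# + m × 1#)) - n × 1#       ≈⟨ +-congʳ (+-comm _ _) ⟩
    ((1# + m × 1#) + - 1#) - n × 1#       ≈⟨ +-assoc _ _ _ ⟩
    (1# + m × 1#) + (- 1# - n × 1#)       ≈⟨ +-congˡ (⁻¹-∙-comm _ _) ⟩
    (1# + m × 1#) - (1# + n × 1#)         ≈⟨ +-cong (×-suc m) (-‿cong (×-suc n)) ⟨
    suc m × 1# - suc n × 1#               ∎

  ⟦⟧-+ : ∀ i j → ⟦ i ℤ.+ j ⟧ ≈ ⟦ i ⟧ + ⟦ j ⟧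
  ⟦⟧-+ (+ m)    (+ n)    = ×-homo-+ 1# m n
  ⟦⟧-+ (+ m)    -[1+ n ] = ⟦⟧-⊖ m (suc n)
  ⟦⟧-+ -[1+ m ] (+ n)    = trans (⟦⟧-⊖ n (suc m)) (+-comm _ _)
  ⟦⟧-+ -[1+ m ] -[1+ n ] = begin
    - (suc (suc (m ℕ.+ n)) × 1#)          ≡⟨ ≡.cong (λ l → - (l × 1#)) (≡.sym (ℕ.+-suc (suc m) n)) ⟩
    - ((suc m ℕ.+ suc n) × 1#)            ≈⟨ -‿cong (×-homo-+ 1# (suc m) (suc n)) ⟩
    - (suc m × 1# + suc n × 1#)           ≈⟨ ⁻¹-∙-comm _ _ ⟨
    - (suc m × 1#) - suc n × 1#           ∎

  ⟦⟧-*⁺ : ∀ m j → ⟦ + m ℤ.* j ⟧ ≈ ⟦ + m ⟧ * ⟦ j ⟧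
  ⟦⟧-*⁺ m (+ n)    = trans (reflexive (≡.cong ⟦_⟧ (≡.sym (ℤ.pos-* m n)))) (×1-homo-* m n)
  ⟦⟧-*⁺ m -[1+ n ] = begin
    ⟦ + m ℤ.* -[1+ n ] ⟧                  ≡⟨ ≡.cong ⟦_⟧ (ℤ.neg-distribʳ-* (+ m) (+ suc n)) ⟨
    ⟦ ℤ.- (+ m ℤ.* + suc n) ⟧             ≈⟨ ⟦⟧-neg (+ m ℤ.* + suc n) ⟩
    - ⟦ + m ℤ.* + suc n ⟧                 ≈⟨ -‿cong (⟦⟧-*⁺ m (+ suc n)) ⟩
    - (⟦ + m ⟧ * ⟦ + suc n ⟧)             ≈⟨ -‿distribʳ-* _ _ ⟩
    ⟦ + m ⟧ * ⟦ -[1+ n ] ⟧                ∎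

  ⟦⟧-* : ∀ i j → ⟦ i ℤ.* j ⟧ ≈ ⟦ i ⟧ * ⟦ j ⟧
  ⟦⟧-* (+ m)    j = ⟦⟧-*⁺ m j
  ⟦⟧-* -[1+ m ] j = begin
    ⟦ -[1+ m ] ℤ.* j ⟧                    ≡⟨ ≡.cong ⟦_⟧ (ℤ.neg-distribˡ-* (+ suc m) j) ⟨
    ⟦ ℤ.- (+ suc m ℤ.* j) ⟧               ≈⟨ ⟦⟧-neg (+ suc m ℤ.* j) ⟩
    - ⟦ + suc m ℤ.* j ⟧                   ≈⟨ -‿cong (⟦⟧-*⁺ (suc m) j) ⟩
    - (⟦ + suc m ⟧ * ⟦ j ⟧)               ≈⟨ -‿distribˡ-* _ _ ⟩
    ⟦ -[1+ m ] ⟧ * ⟦ j ⟧                  ∎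

  morphism : ℤ.+-*-rawRing -Raw-AlmostCommutative⟶ fromCommutativeRing R
  morphism = record
    { ⟦_⟧ = ⟦_⟧ ; +-homo = ⟦⟧-+ ; *-homo = ⟦⟧-* ; -‿homo = ⟦⟧-neg ; 0-homo = refl ; 1-homo = refl }

  open RingSolver ℤ.+-*-rawRing (fromCommutativeRing R) morphism
    (λ i j → map (λ i≡j → reflexive (≡.cong ⟦_⟧ i≡j)) (dec⇒maybe (i ℤ.≟ j))) public
    using (solve; _:=_; _:+_; _:*_; _:-_; :-_; con)

-- Finite sums of integers, Cauchy-Schwarz, delta and indicator functions.

module IntegerSums where
  open import Data.Bool.Base using (if_then_else_)
  open import Data.Fin.Base using (Fin; zero; suc)
  open import Data.Fin.Permutation using (permutation)
  import Data.Fin.Properties as Fin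
  open import Data.Fin.Subset using (Subset; inside; outside; _∈_; _∉_; ∣_∣)
  open import Data.Integer.Base hiding (∣_∣; suc)
  open import Data.Integer.Properties
  open import Data.Integer.Tactic.RingSolver using (solve-∀)
  open import Data.Nat.Base as ℕ using (ℕ; zero; suc)
  open import Data.Vec.Base using ([]; _∷_; lookup)
  open import Data.Vec.Properties using ([]=⇒lookup; lookup⇒[]=)
  open import Function.Base using (_∘_)
  open import Relation.Binary.PropositionalEquality
  open import Relation.Nullary using (does; yes; no; contradiction)
  import Algebra.Properties.Semiring.Sum +-*-semiring as Sum

  infixr 6.5 ∑-syntax

  abstract
    ∑-syntax : ∀ {n} → (Fin n → ℤ) → ℤ
    ∑-syntax = Sum.sum

  syntax ∑-syntax (λ i → x) = ∑[ i ] x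

  *-monoˡ : ∀ {a b c} → 0ℤ ≤ a → b ≤ c → a * b ≤ a * c
  *-monoˡ {a} 0≤a = *-monoˡ-≤-nonNeg a {{nonNegative 0≤a}}

  *-monoʳ : ∀ {a b c} → 0ℤ ≤ a → b ≤ c → b * a ≤ c * a
  *-monoʳ {a} 0≤a = *-monoʳ-≤-nonNeg a {{nonNegative 0≤a}}

  *-nonNeg : ∀ {a b} → 0ℤ ≤ a → 0ℤ ≤ b → 0ℤ ≤ a * b
  *-nonNeg {a} {b} 0≤a 0≤b = subst (_≤ a * b) (*-zeroʳ a) (*-monoˡ 0≤a 0≤b)

  square-nonNeg : ∀ a → 0ℤ ≤ a * a
  square-nonNeg (+ n)    = subst (0ℤ ≤_) (pos-* n n) (+≤+ ℕ.z≤n)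
  square-nonNeg -[1+ n ] = +≤+ ℕ.z≤n

  square-mono : ∀ {a b} → 0ℤ ≤ a → a ≤ b → a * a ≤ b * b
  square-mono 0≤a a≤b = ≤-trans (*-monoˡ 0≤a a≤b) (*-monoʳ (≤-trans 0≤a a≤b) a≤b)

  abstract
    ∑-cong : ∀ {n} {f g : Fin n → ℤ} → (∀ i → f i ≡ g i) → ∑[ i ] f i ≡ ∑[ i ] g i
    ∑-cong = Sum.sum-cong-≗

    ∑-mono : ∀ {n} {f g : Fin n → ℤ} → (∀ i → f i ≤ g i) → ∑[ i ] f i ≤ ∑[ i ] g i
    ∑-mono {zero}  f≤g = ≤-refl
    ∑-mono {suc n} f≤g = +-mono-≤ (f≤g zero) (∑-mono (f≤g ∘ suc))

    ∑-nonNeg : ∀ {n} {f : Fin n → ℤ} → (∀ i → 0ℤ ≤ f i) → 0ℤ ≤ ∑[ i ] f i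
    ∑-nonNeg {zero}  0≤f = ≤-refl
    ∑-nonNeg {suc n} 0≤f = +-mono-≤ (0≤f zero) (∑-nonNeg (0≤f ∘ suc))

    -- The summand is an applied constant function because its bound variable has to carry the index
    -- type.
    ∑-const : ∀ n a → ∑[ i ] (λ (_ : Fin n) → a) i ≡ + n * a
    ∑-const zero    a = sym (*-zeroˡ a)
    ∑-const (suc n) a = trans (cong (λ b → a + b) (∑-const n a))
      (trans (cong (_+ + n * a) (sym (*-identityˡ a))) (sym (*-distribʳ-+ a (+ 1) (+ n))))

    ∑-+ : ∀ {n} (f g : Fin n → ℤ) → ∑[ i ] (f i + g i) ≡ ∑[ i ] f i + ∑[ i ] g i
    ∑-+ = Sum.∑-distrib-+

    ∑-comm : ∀ {m n} (f : Fin m → Fin n → ℤ) → ∑[ i ] ∑[ j ] f i j ≡ ∑[ j ] ∑[ i ] f i j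
    ∑-comm = Sum.∑-comm

    *-∑ : ∀ {n} a (f : Fin n → ℤ) → a * (∑[ i ] f i) ≡ ∑[ i ] a * f i
    *-∑ = Sum.*-distribˡ-sum

    ∑-* : ∀ {n} (f : Fin n → ℤ) a → (∑[ i ] f i) * a ≡ ∑[ i ] f i * a
    ∑-* f a = Sum.*-distribʳ-sum a f

    ∑-*-∑ : ∀ {m n} (f : Fin m → ℤ) (g : Fin n → ℤ) →
            (∑[ i ] f i) * (∑[ j ] g j) ≡ ∑[ i ] ∑[ j ] f i * g j
    ∑-*-∑ f g = trans (∑-* f _) (∑-cong λ i → *-∑ (f i) g)

    ∑-reindex : ∀ {n} (f : Fin n → ℤ) (to from : Fin n → Fin n) →
                (∀ i → to (from i) ≡ i) → (∀ i → from (to i) ≡ i) →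
                ∑[ i ] f (to i) ≡ ∑[ i ] f i
    ∑-reindex f to from to∘from from∘to = sym (Sum.sum-permute f (permutation to from to∘from from∘to))

    -- Cauchy-Schwarz against the constant 1. Splitting off the first value a increases n Σ f² - (Σ
    -- f)² by exactly the sum of (a - f i)² over the remaining i.
    ∑²≤n*∑² : ∀ {n} (f : Fin n → ℤ) → (∑[ i ] f i) * (∑[ i ] f i) ≤ + n * (∑[ i ] f i * f i)
    ∑²≤n*∑² {zero}  f = ≤-refl
    ∑²≤n*∑² {suc n} f = 0≤i-j⇒j≤i (subst (0ℤ ≤_) (sym eq)
        (+-mono-≤ (∑-nonNeg λ i → square-nonNeg (a - g i)) (i≤j⇒0≤j-i (∑²≤n*∑² g))))
      where
      a : ℤ
      a = f zero
      g : Fin n → ℤ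
      g = f ∘ suc
      s t : ℤ
      s = ∑[ i ] g i
      t = ∑[ i ] g i * g i
      expand : ∑[ i ] ((a - g i) * (a - g i)) ≡ + n * (a * a) + ((- (+ 2 * a)) * s + t)
      expand = begin
        ∑[ i ] ((a - g i) * (a - g i))                    ≡⟨ ∑-cong (λ i → lemma a (g i)) ⟩
        ∑[ i ] (a * a + ((- (+ 2 * a)) * g i + g i * g i)) ≡⟨ ∑-+ (λ _ → a * a) (λ i → (- (+ 2 * a)) * g i + g i * g i) ⟩
        ∑[ i ] (λ (_ : Fin n) → a * a) i + ∑[ i ] ((- (+ 2 * a)) * g i + g i * g i)
          ≡⟨ cong₂ _+_ (∑-const n (a * a)) (trans (∑-+ (λ i → (- (+ 2 * a)) * g i) (λ i → g i * g i))
               (cong (_+ t) (sym (*-∑ (- (+ 2 * a)) g)))) ⟩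
        + n * (a * a) + ((- (+ 2 * a)) * s + t)           ∎
        where
        open ≡-Reasoning
        lemma : ∀ a b → (a - b) * (a - b) ≡ a * a + ((- (+ 2 * a)) * b + b * b)
        lemma = solve-∀
      eq : + suc n * (a * a + t) - (a + s) * (a + s) ≡
           ∑[ i ] ((a - g i) * (a - g i)) + (+ n * t - s * s)
      eq = trans (lemma (+ n) a s t) (cong (_+ (+ n * t - s * s)) (sym expand))
        where
        lemma : ∀ m a s t → (+ 1 + m) * (a * a + t) - (a + s) * (a + s) ≡
                (m * (a * a) + ((- (+ 2 * a)) * s + t)) + (m * t - s * s)
        lemma = solve-∀

  -- Going through `does` makes `δ (suc i) (suc j)` equal to `δ i j` by computation, as the
  -- induction in `∑-δ` requires.
  δ : ∀ {n} → Fin n → Fin n → ℤ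
  δ i j = if does (i Fin.≟ j) then 1ℤ else 0ℤ

  δ-nonNeg : ∀ {n} (i j : Fin n) → 0ℤ ≤ δ i j
  δ-nonNeg i j with i Fin.≟ j
  ... | yes _ = +≤+ ℕ.z≤n
  ... | no  _ = ≤-refl

  δ-≢ : ∀ {n} {i j : Fin n} → i ≢ j → δ i j ≡ 0ℤ
  δ-≢ {i = i} {j} i≢j with i Fin.≟ j
  ... | yes i≡j = contradiction i≡j i≢j
  ... | no  _   = refl

  δ-≡ : ∀ {n} {i j : Fin n} → i ≡ j → δ i j ≡ 1ℤ
  δ-≡ {i = i} {j} i≡j with i Fin.≟ j
  ... | yes _   = refl
  ... | no  i≢j = contradiction i≡j i≢j

  abstract
    ∑-δ : ∀ {n} (i : Fin n) (f : Fin n → ℤ) → ∑[ j ] δ i j * f j ≡ f i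
    ∑-δ {suc n} zero f = begin
      1ℤ * f zero + ∑[ j ] 0ℤ * f (suc j) ≡⟨ cong₂ _+_ (*-identityˡ (f zero)) (sym (*-∑ 0ℤ (f ∘ suc))) ⟩
      f zero + 0ℤ * (∑[ j ] f (suc j))    ≡⟨ cong (λ b → f zero + b) (*-zeroˡ (∑[ j ] f (suc j))) ⟩
      f zero + 0ℤ                         ≡⟨ +-identityʳ (f zero) ⟩
      f zero                              ∎
      where open ≡-Reasoning
    ∑-δ {suc n} (suc i) f = begin
      0ℤ * f zero + ∑[ j ] δ (suc i) (suc j) * f (suc j) ≡⟨ cong (_+ ∑[ j ] δ (suc i) (suc j) * f (suc j)) (*-zeroˡ (f zero)) ⟩
      0ℤ + ∑[ j ] δ (suc i) (suc j) * f (suc j)          ≡⟨ +-identityˡ _ ⟩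
      ∑[ j ] δ i j * f (suc j)                           ≡⟨ ∑-δ i (f ∘ suc) ⟩
      f (suc i)                                          ∎
      where open ≡-Reasoning

  χ : ∀ {n} → Subset n → Fin n → ℤ
  χ X i = if lookup X i then 1ℤ else 0ℤ

  χ-∈ : ∀ {n} {X : Subset n} {i} → i ∈ X → χ X i ≡ 1ℤ
  χ-∈ i∈X = cong (if_then 1ℤ else 0ℤ) ([]=⇒lookup i∈X)

  χ-∉ : ∀ {n} {X : Subset n} {i} → i ∉ X → χ X i ≡ 0ℤ
  χ-∉ {X = X} {i} i∉X with lookup X i in eq
  ... | inside  = contradiction (lookup⇒[]= i X eq) i∉X
  ... | outside = refl

  χ-nonNeg : ∀ {n} (X : Subset n) i → 0ℤ ≤ χ X i
  χ-nonNeg X i with lookup X i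
  ... | inside  = +≤+ ℕ.z≤n
  ... | outside = ≤-refl

  χ≤1 : ∀ {n} (X : Subset n) i → χ X i ≤ 1ℤ
  χ≤1 X i with lookup X i
  ... | inside  = ≤-refl
  ... | outside = +≤+ ℕ.z≤n

  χ-idem : ∀ {n} (X : Subset n) i → χ X i * χ X i ≡ χ X i
  χ-idem X i with lookup X i
  ... | inside  = refl
  ... | outside = refl

  abstract
    ∑-χ : ∀ {n} (X : Subset n) → ∑[ i ] χ X i ≡ + ∣ X ∣
    ∑-χ []            = refl
    ∑-χ (inside  ∷ X) = cong (λ b → 1ℤ + b) (∑-χ X)
    ∑-χ (outside ∷ X) = trans (+-identityˡ _) (∑-χ X)

-- Natural powers of rationals, and the bound for the complement with all exponents cleared.

module RationalPowers where
  open import Defs using (fromℕ; _^ℚ_)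
  open import Data.Integer.Base as ℤ using (+_)
  import Data.Integer.Properties as ℤ
  open import Data.Nat.Base as ℕ using (ℕ; zero; suc)
  import Data.Nat.Properties as ℕ
  open import Data.Nat.Tactic.RingSolver using (solve-∀)
  open import Data.Rational.Base
  open import Data.Rational.Properties
  open import Data.Rational.Solver using (module +-*-Solver)
  import Data.Rational.Unnormalised.Base as ℚᵘ
  import Data.Rational.Unnormalised.Properties as ℚᵘ
  open import Relation.Binary.PropositionalEquality
  open import Relation.Nullary using (yes; no; contradiction)
  open import Algebra.Properties.Semiring.Exp (CommutativeRing.semiring +-*-commutativeRing) public
    using (^-homo-*; ^-assocʳ)
  open import Algebra.Properties.CommutativeSemiring.Exp (CommutativeRing.commutativeSemiring +-*-commutativeRing) public
    using (^-distrib-*)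

  -- A stand-in for `fromℕ`, which normalises its fraction and therefore does not reduce at a
  -- variable numerator.
  fromℕᵘ : ℕ → ℚᵘ.ℚᵘ
  fromℕᵘ n = ℚᵘ.mkℚᵘ (+ n) 0

  toℚᵘ-fromℕ : ∀ n → toℚᵘ (fromℕ n) ℚᵘ.≃ fromℕᵘ n
  toℚᵘ-fromℕ n = toℚᵘ-fromℚᵘ (fromℕᵘ n)

  fromℕ-* : ∀ m n → fromℕ (m ℕ.* n) ≡ fromℕ m * fromℕ n
  fromℕ-* m n = toℚᵘ-injective (begin-equality
    toℚᵘ (fromℕ (m ℕ.* n))             ≃⟨ toℚᵘ-fromℕ (m ℕ.* n) ⟩
    fromℕᵘ (m ℕ.* n)                   ≃⟨ ℚᵘ.*≡* (cong (ℤ._* + 1) (ℤ.pos-* m n)) ⟩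
    fromℕᵘ m ℚᵘ.* fromℕᵘ n             ≃⟨ ℚᵘ.*-cong (toℚᵘ-fromℕ m) (toℚᵘ-fromℕ n) ⟨
    toℚᵘ (fromℕ m) ℚᵘ.* toℚᵘ (fromℕ n) ≃⟨ toℚᵘ-homo-* (fromℕ m) (fromℕ n) ⟨
    toℚᵘ (fromℕ m * fromℕ n)           ∎)
    where open ℚᵘ.≤-Reasoning

  fromℕ-mono : ∀ {m n} → m ℕ.≤ n → fromℕ m ≤ fromℕ n
  fromℕ-mono {m} {n} m≤n = toℚᵘ-cancel-≤ (begin
    toℚᵘ (fromℕ m)   ≃⟨ toℚᵘ-fromℕ m ⟩
    fromℕᵘ m         ≤⟨ ℚᵘ.*≤* (ℤ.*-monoʳ-≤-nonNeg (+ 1) (ℤ.+≤+ m≤n)) ⟩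
    fromℕᵘ n         ≃⟨ toℚᵘ-fromℕ n ⟨
    toℚᵘ (fromℕ n)   ∎)
    where open ℚᵘ.≤-Reasoning

  fromℕ-nonNeg : ∀ n → 0ℚ ≤ fromℕ n
  fromℕ-nonNeg n = fromℕ-mono {0} {n} ℕ.z≤n

  fromℕ-^ : ∀ m n → fromℕ (m ℕ.^ n) ≡ fromℕ m ^ℚ n
  fromℕ-^ m zero    = refl
  fromℕ-^ m (suc n) = trans (fromℕ-* m (m ℕ.^ n)) (cong (fromℕ m *_) (fromℕ-^ m n))

  *-monoˡ : ∀ {a b c} → 0ℚ ≤ a → b ≤ c → a * b ≤ a * c
  *-monoˡ {a} 0≤a = *-monoˡ-≤-nonNeg a {{nonNegative 0≤a}}

  *-monoʳ : ∀ {a b c} → 0ℚ ≤ a → b ≤ c → b * a ≤ c * a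
  *-monoʳ {a} 0≤a = *-monoʳ-≤-nonNeg a {{nonNegative 0≤a}}

  *-mono : ∀ {a b c d} → 0ℚ ≤ a → a ≤ b → 0ℚ ≤ c → c ≤ d → a * c ≤ b * d
  *-mono 0≤a a≤b 0≤c c≤d = ≤-trans (*-monoʳ 0≤c a≤b) (*-monoˡ (≤-trans 0≤a a≤b) c≤d)

  *-nonNeg : ∀ {a b} → 0ℚ ≤ a → 0ℚ ≤ b → 0ℚ ≤ a * b
  *-nonNeg {a} {b} 0≤a 0≤b = subst (_≤ a * b) (*-zeroʳ a) (*-monoˡ 0≤a 0≤b)

  *-pos : ∀ {a b} → 0ℚ < a → 0ℚ < b → 0ℚ < a * b
  *-pos {a} {b} 0<a 0<b = subst (_< a * b) (*-zeroʳ a) (*-monoʳ-<-pos a {{positive 0<a}} 0<b)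

  0<1 : 0ℚ < 1ℚ
  0<1 = positive⁻¹ 1ℚ

  ^-nonNeg : ∀ {a} n → 0ℚ ≤ a → 0ℚ ≤ a ^ℚ n
  ^-nonNeg zero    0≤a = <⇒≤ 0<1
  ^-nonNeg (suc n) 0≤a = *-nonNeg 0≤a (^-nonNeg n 0≤a)

  ^-pos : ∀ {a} n → 0ℚ < a → 0ℚ < a ^ℚ n
  ^-pos zero    0<a = 0<1
  ^-pos (suc n) 0<a = *-pos 0<a (^-pos n 0<a)

  ^-mono : ∀ {a b} n → 0ℚ ≤ a → a ≤ b → a ^ℚ n ≤ b ^ℚ n
  ^-mono zero    0≤a a≤b = ≤-refl
  ^-mono (suc n) 0≤a a≤b = *-mono 0≤a a≤b (^-nonNeg n 0≤a) (^-mono n 0≤a a≤b)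

  ^-mono-< : ∀ {a b} n → 0ℚ ≤ a → a < b → a ^ℚ suc n < b ^ℚ suc n
  ^-mono-< {a} {b} n 0≤a a<b = ≤-<-trans
    (*-monoˡ 0≤a (^-mono n 0≤a (<⇒≤ a<b)))
    (*-monoˡ-<-pos (b ^ℚ n) {{positive (^-pos n (≤-<-trans 0≤a a<b))}} a<b)

  ^-cancel-≤ : ∀ {a b} n → .{{ℕ.NonZero n}} → 0ℚ ≤ b → a ^ℚ n ≤ b ^ℚ n → a ≤ b
  ^-cancel-≤ {a} {b} (suc n) 0≤b aⁿ≤bⁿ with a ≤? b
  ... | yes a≤b = a≤b
  ... | no  a≰b = contradiction (<-≤-trans (^-mono-< n 0≤b (≰⇒> a≰b)) aⁿ≤bⁿ) (<-irrefl refl)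

  1≤⇒^-≤-suc : ∀ {a} n → 1ℚ ≤ a → a ^ℚ n ≤ a ^ℚ suc n
  1≤⇒^-≤-suc {a} n 1≤a = subst (_≤ a * a ^ℚ n) (*-identityˡ (a ^ℚ n))
    (*-monoʳ (^-nonNeg n (≤-trans (<⇒≤ 0<1) 1≤a)) 1≤a)

  ^-*-^ : ∀ a b i j n → (a ^ℚ i * b ^ℚ j) ^ℚ n ≡ a ^ℚ (i ℕ.* n) * b ^ℚ (j ℕ.* n)
  ^-*-^ a b i j n = trans (^-distrib-* (a ^ℚ i) (b ^ℚ j) n) (cong₂ _*_ (^-assocʳ a i n) (^-assocʳ b j n))

  -- All exponents are natural numbers: b and c are denominators, and the
  -- positive and the negative part of a numerator are kept on opposite sides.
  module _ {Q K x y z w ρ r : ℚ} (1≤Q : 1ℚ ≤ Q) (0≤K : 0ℚ ≤ K)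
           (0≤x : 0ℚ ≤ x) (0≤y : 0ℚ ≤ y) (0≤z : 0ℚ ≤ z) (0≤w : 0ℚ ≤ w) (0<ρ : 0ℚ < ρ) (0<r : 0ℚ < r)
           (K≤ : K ≤ r * ρ ^ℚ 3)
           (product≤ : (x * y * z * w) ^ℚ 2 ≤ K ^ℚ 2 * Q ^ℚ 7)
           (b c : ℕ) .{{_ : ℕ.NonZero c}} (a⁺ a⁻ d⁺ d⁻ : ℕ)
           (exponents : 3 ℕ.* (a⁺ ℕ.* c) ℕ.+ 9 ℕ.* (d⁺ ℕ.* b) ≡
                        11 ℕ.* (b ℕ.* c) ℕ.+ 3 ℕ.* (a⁻ ℕ.* c) ℕ.+ 9 ℕ.* (d⁻ ℕ.* b))
           (x≥ : ρ ^ℚ c * Q ^ℚ d⁺ ≤ x ^ℚ c * Q ^ℚ d⁻)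
           (y≥ : ρ ^ℚ c * Q ^ℚ d⁺ ≤ y ^ℚ c * Q ^ℚ d⁻)
           (z≥ : ρ ^ℚ c * Q ^ℚ d⁺ ≤ z ^ℚ c * Q ^ℚ d⁻) where

    private
      open +-*-Solver using (solve; _:=_; _:*_)

      0≤Q : 0ℚ ≤ Q
      0≤Q = ≤-trans (<⇒≤ 0<1) 1≤Q

      -- The quotient of `lower-term` by `upper-term` is the c-th power of ρ Q^t for t = (d⁺ -
      -- d⁻)/c.
      lower-term upper-term R π : ℚ
      lower-term = ρ ^ℚ c * Q ^ℚ d⁺
      upper-term = Q ^ℚ d⁻
      R = r * ρ ^ℚ 3
      π = x * y * z * w

      0<lower-term : 0ℚ < lower-term
      0<lower-term = *-pos (^-pos c 0<ρ) (^-pos d⁺ (<-≤-trans 0<1 1≤Q))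

      0≤lower-term : 0ℚ ≤ lower-term
      0≤lower-term = <⇒≤ 0<lower-term

      cubed : w ^ℚ c * lower-term ^ℚ 3 ≤ π ^ℚ c * upper-term ^ℚ 3
      cubed = begin
        w ^ℚ c * (lower-term * (lower-term * (lower-term * 1ℚ)))
          ≤⟨ *-monoˡ (^-nonNeg c 0≤w) (*-mono 0≤lower-term x≥ (*-nonNeg 0≤lower-term (*-nonNeg 0≤lower-term (<⇒≤ 0<1)))
               (*-mono 0≤lower-term y≥ (*-nonNeg 0≤lower-term (<⇒≤ 0<1)) (*-monoʳ (<⇒≤ 0<1) z≥))) ⟩
        w ^ℚ c * ((x ^ℚ c * upper-term) * ((y ^ℚ c * upper-term) * ((z ^ℚ c * upper-term) * 1ℚ)))
          ≡⟨ solve 6 (λ x y z w u e → w :* ((x :* u) :* ((y :* u) :* ((z :* u) :* e))) := (x :* y :* z :* w) :* (u :* (u :* (u :* e)))) refl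
               (x ^ℚ c) (y ^ℚ c) (z ^ℚ c) (w ^ℚ c) upper-term 1ℚ ⟩
        (x ^ℚ c * y ^ℚ c * z ^ℚ c * w ^ℚ c) * upper-term ^ℚ 3
          ≡⟨ cong (_* upper-term ^ℚ 3) (trans (^-distrib-* (x * y * z) w c) (cong (_* w ^ℚ c)
               (trans (^-distrib-* (x * y) z c) (cong (_* z ^ℚ c) (^-distrib-* x y c))))) ⟨
        π ^ℚ c * upper-term ^ℚ 3 ∎
        where open ≤-Reasoning

      collect-left : (w ^ℚ b * Q ^ℚ a⁻) ^ℚ (6 ℕ.* c) * lower-term ^ℚ (18 ℕ.* b) ≡
                     (w ^ℚ c * lower-term ^ℚ 3) ^ℚ (6 ℕ.* b) * Q ^ℚ (a⁻ ℕ.* (6 ℕ.* c))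
      collect-left = begin
        (w ^ℚ b * Q ^ℚ a⁻) ^ℚ (6 ℕ.* c) * lower-term ^ℚ (18 ℕ.* b)
          ≡⟨ cong (_* lower-term ^ℚ (18 ℕ.* b)) (^-*-^ w Q b a⁻ (6 ℕ.* c)) ⟩
        w ^ℚ (b ℕ.* (6 ℕ.* c)) * Q ^ℚ (a⁻ ℕ.* (6 ℕ.* c)) * lower-term ^ℚ (18 ℕ.* b)
          ≡⟨ cong₂ (λ i j → w ^ℚ i * Q ^ℚ (a⁻ ℕ.* (6 ℕ.* c)) * lower-term ^ℚ j) (eq₁ b c) (eq₂ b) ⟩
        w ^ℚ (c ℕ.* (6 ℕ.* b)) * Q ^ℚ (a⁻ ℕ.* (6 ℕ.* c)) * lower-term ^ℚ (3 ℕ.* (6 ℕ.* b))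
          ≡⟨ solve 3 (λ x y z → x :* y :* z := x :* z :* y) refl (w ^ℚ (c ℕ.* (6 ℕ.* b))) (Q ^ℚ (a⁻ ℕ.* (6 ℕ.* c))) (lower-term ^ℚ (3 ℕ.* (6 ℕ.* b))) ⟩
        w ^ℚ (c ℕ.* (6 ℕ.* b)) * lower-term ^ℚ (3 ℕ.* (6 ℕ.* b)) * Q ^ℚ (a⁻ ℕ.* (6 ℕ.* c))
          ≡⟨ cong (_* Q ^ℚ (a⁻ ℕ.* (6 ℕ.* c))) (^-*-^ w lower-term c 3 (6 ℕ.* b)) ⟨
        (w ^ℚ c * lower-term ^ℚ 3) ^ℚ (6 ℕ.* b) * Q ^ℚ (a⁻ ℕ.* (6 ℕ.* c)) ∎
        where
        open ≡-Reasoning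
        eq₁ : ∀ b c → b ℕ.* (6 ℕ.* c) ≡ c ℕ.* (6 ℕ.* b)
        eq₁ = solve-∀
        eq₂ : ∀ b → 18 ℕ.* b ≡ 3 ℕ.* (6 ℕ.* b)
        eq₂ = solve-∀

      π²-bound : (π ^ℚ 2) ^ℚ (3 ℕ.* (b ℕ.* c)) ≤ R ^ℚ (6 ℕ.* (b ℕ.* c)) * Q ^ℚ (22 ℕ.* (b ℕ.* c))
      π²-bound = begin
        (π ^ℚ 2) ^ℚ (3 ℕ.* n)
          ≤⟨ ^-mono (3 ℕ.* n) (^-nonNeg 2 (*-nonNeg (*-nonNeg (*-nonNeg 0≤x 0≤y) 0≤z) 0≤w))
               (≤-trans product≤ (*-monoʳ (^-nonNeg 7 0≤Q) (^-mono 2 0≤K K≤))) ⟩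
        (R ^ℚ 2 * Q ^ℚ 7) ^ℚ (3 ℕ.* n)
          ≡⟨ ^-*-^ R Q 2 7 (3 ℕ.* n) ⟩
        R ^ℚ (2 ℕ.* (3 ℕ.* n)) * Q ^ℚ (7 ℕ.* (3 ℕ.* n))
          ≡⟨ cong₂ (λ i j → R ^ℚ i * Q ^ℚ j) (eq₁ n) (eq₂ n) ⟩
        R ^ℚ (6 ℕ.* n) * Q ^ℚ (21 ℕ.* n)
          -- The exponent 7 = 21/3 is relaxed to 22/3, twice the 11/3 that `exponents` encodes, so
          -- that the powers of Q balance exactly in `collect-right`.
          ≤⟨ *-monoˡ (^-nonNeg (6 ℕ.* n) (≤-trans 0≤K K≤)) Q²¹≤Q²² ⟩
        R ^ℚ (6 ℕ.* n) * Q ^ℚ (22 ℕ.* n) ∎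
        where
        open ≤-Reasoning
        n : ℕ
        n = b ℕ.* c
        eq₁ : ∀ n → 2 ℕ.* (3 ℕ.* n) ≡ 6 ℕ.* n
        eq₁ = solve-∀
        eq₂ : ∀ n → 7 ℕ.* (3 ℕ.* n) ≡ 21 ℕ.* n
        eq₂ = solve-∀
        Q²¹≤Q²² : Q ^ℚ (21 ℕ.* n) ≤ Q ^ℚ (22 ℕ.* n)
        Q²¹≤Q²² = subst₂ _≤_ (^-assocʳ Q 21 n) (^-assocʳ Q 22 n)
          (^-mono n (^-nonNeg 21 0≤Q) (1≤⇒^-≤-suc 21 1≤Q))

      collect-right : R ^ℚ (6 ℕ.* (b ℕ.* c)) * Q ^ℚ (22 ℕ.* (b ℕ.* c)) * Q ^ℚ ((d⁻ ℕ.* 3) ℕ.* (6 ℕ.* b)) * Q ^ℚ (a⁻ ℕ.* (6 ℕ.* c)) ≡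
                      (r ^ℚ b * Q ^ℚ a⁺) ^ℚ (6 ℕ.* c) * lower-term ^ℚ (18 ℕ.* b)
      collect-right = begin
        R ^ℚ (6 ℕ.* (b ℕ.* c)) * Q ^ℚ (22 ℕ.* (b ℕ.* c)) * Q ^ℚ ((d⁻ ℕ.* 3) ℕ.* (6 ℕ.* b)) * Q ^ℚ (a⁻ ℕ.* (6 ℕ.* c))
          ≡⟨ trans (*-assoc (R ^ℚ (6 ℕ.* (b ℕ.* c)) * Q ^ℚ (22 ℕ.* (b ℕ.* c))) (Q ^ℚ ((d⁻ ℕ.* 3) ℕ.* (6 ℕ.* b))) _)
               (*-assoc (R ^ℚ (6 ℕ.* (b ℕ.* c))) (Q ^ℚ (22 ℕ.* (b ℕ.* c))) _) ⟩
        R ^ℚ (6 ℕ.* (b ℕ.* c)) * (Q ^ℚ (22 ℕ.* (b ℕ.* c)) * (Q ^ℚ ((d⁻ ℕ.* 3) ℕ.* (6 ℕ.* b)) * Q ^ℚ (a⁻ ℕ.* (6 ℕ.* c))))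
          ≡⟨ cong₂ _*_ R-power Q-power ⟩
        r ^ℚ (b ℕ.* (6 ℕ.* c)) * ρ ^ℚ (c ℕ.* (18 ℕ.* b)) * (Q ^ℚ (a⁺ ℕ.* (6 ℕ.* c)) * Q ^ℚ (d⁺ ℕ.* (18 ℕ.* b)))
          ≡⟨ solve 4 (λ x y z w → x :* y :* (z :* w) := (x :* z) :* (y :* w)) refl
               (r ^ℚ (b ℕ.* (6 ℕ.* c))) (ρ ^ℚ (c ℕ.* (18 ℕ.* b))) (Q ^ℚ (a⁺ ℕ.* (6 ℕ.* c))) (Q ^ℚ (d⁺ ℕ.* (18 ℕ.* b))) ⟩
        (r ^ℚ (b ℕ.* (6 ℕ.* c)) * Q ^ℚ (a⁺ ℕ.* (6 ℕ.* c))) * (ρ ^ℚ (c ℕ.* (18 ℕ.* b)) * Q ^ℚ (d⁺ ℕ.* (18 ℕ.* b)))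
          ≡⟨ cong₂ _*_ (^-*-^ r Q b a⁺ (6 ℕ.* c)) (^-*-^ ρ Q c d⁺ (18 ℕ.* b)) ⟨
        (r ^ℚ b * Q ^ℚ a⁺) ^ℚ (6 ℕ.* c) * lower-term ^ℚ (18 ℕ.* b) ∎
        where
        open ≡-Reasoning
        R-power : R ^ℚ (6 ℕ.* (b ℕ.* c)) ≡ r ^ℚ (b ℕ.* (6 ℕ.* c)) * ρ ^ℚ (c ℕ.* (18 ℕ.* b))
        R-power = trans (^-distrib-* r (ρ ^ℚ 3) (6 ℕ.* (b ℕ.* c))) (trans (cong (r ^ℚ (6 ℕ.* (b ℕ.* c)) *_) (^-assocʳ ρ 3 (6 ℕ.* (b ℕ.* c))))
          (cong₂ (λ i j → r ^ℚ i * ρ ^ℚ j) (eq₁ b c) (eq₂ b c)))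
          where
          eq₁ : ∀ b c → 6 ℕ.* (b ℕ.* c) ≡ b ℕ.* (6 ℕ.* c)
          eq₁ = solve-∀
          eq₂ : ∀ b c → 3 ℕ.* (6 ℕ.* (b ℕ.* c)) ≡ c ℕ.* (18 ℕ.* b)
          eq₂ = solve-∀
        Q-power : Q ^ℚ (22 ℕ.* (b ℕ.* c)) * (Q ^ℚ ((d⁻ ℕ.* 3) ℕ.* (6 ℕ.* b)) * Q ^ℚ (a⁻ ℕ.* (6 ℕ.* c))) ≡
                  Q ^ℚ (a⁺ ℕ.* (6 ℕ.* c)) * Q ^ℚ (d⁺ ℕ.* (18 ℕ.* b))
        Q-power = begin
          Q ^ℚ (22 ℕ.* (b ℕ.* c)) * (Q ^ℚ ((d⁻ ℕ.* 3) ℕ.* (6 ℕ.* b)) * Q ^ℚ (a⁻ ℕ.* (6 ℕ.* c)))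
            ≡⟨ trans (^-homo-* Q (22 ℕ.* (b ℕ.* c)) _) (cong (Q ^ℚ (22 ℕ.* (b ℕ.* c)) *_) (^-homo-* Q ((d⁻ ℕ.* 3) ℕ.* (6 ℕ.* b)) (a⁻ ℕ.* (6 ℕ.* c)))) ⟨
          Q ^ℚ (22 ℕ.* (b ℕ.* c) ℕ.+ ((d⁻ ℕ.* 3) ℕ.* (6 ℕ.* b) ℕ.+ a⁻ ℕ.* (6 ℕ.* c)))
            ≡⟨ cong (Q ^ℚ_) (trans (eq₁ b c a⁻ d⁻) (trans (cong (2 ℕ.*_) (sym exponents)) (eq₂ b c a⁺ d⁺))) ⟩
          Q ^ℚ (a⁺ ℕ.* (6 ℕ.* c) ℕ.+ d⁺ ℕ.* (18 ℕ.* b))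
            ≡⟨ ^-homo-* Q (a⁺ ℕ.* (6 ℕ.* c)) (d⁺ ℕ.* (18 ℕ.* b)) ⟩
          Q ^ℚ (a⁺ ℕ.* (6 ℕ.* c)) * Q ^ℚ (d⁺ ℕ.* (18 ℕ.* b)) ∎
          where
          eq₁ : ∀ b c a⁻ d⁻ → 22 ℕ.* (b ℕ.* c) ℕ.+ ((d⁻ ℕ.* 3) ℕ.* (6 ℕ.* b) ℕ.+ a⁻ ℕ.* (6 ℕ.* c)) ≡
                2 ℕ.* (11 ℕ.* (b ℕ.* c) ℕ.+ 3 ℕ.* (a⁻ ℕ.* c) ℕ.+ 9 ℕ.* (d⁻ ℕ.* b))
          eq₁ = solve-∀
          eq₂ : ∀ b c a⁺ d⁺ → 2 ℕ.* (3 ℕ.* (a⁺ ℕ.* c) ℕ.+ 9 ℕ.* (d⁺ ℕ.* b)) ≡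
                a⁺ ℕ.* (6 ℕ.* c) ℕ.+ d⁺ ℕ.* (18 ℕ.* b)
          eq₂ = solve-∀

    -- With s = (a⁺ - a⁻)/b and t = (d⁺ - d⁻)/c, `exponents` is s + 3 t = 11/3 multiplied by 3 b c,
    -- and the claim is the b-th power of w ≤ r Q^s. It is compared after raising to the power 6 c:
    -- c is the denominator of t, the 2 matches the squared product bound, and the 3 clears the
    -- exponent 22/3. Multiplying by a power of `lower-term` and cancelling it replaces the division
    -- by x y z.
    complement-power-bound : w ^ℚ b * Q ^ℚ a⁻ ≤ r ^ℚ b * Q ^ℚ a⁺
    complement-power-bound = ^-cancel-≤ (6 ℕ.* c) {{ℕ.m*n≢0 6 c}}
      (*-nonNeg (^-nonNeg b (<⇒≤ 0<r)) (^-nonNeg a⁺ 0≤Q))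
      (*-cancelʳ-≤-pos (lower-term ^ℚ (18 ℕ.* b)) {{positive (^-pos (18 ℕ.* b) 0<lower-term)}} (begin
        (w ^ℚ b * Q ^ℚ a⁻) ^ℚ (6 ℕ.* c) * lower-term ^ℚ (18 ℕ.* b)
          ≡⟨ collect-left ⟩
        (w ^ℚ c * lower-term ^ℚ 3) ^ℚ (6 ℕ.* b) * Q ^ℚ (a⁻ ℕ.* (6 ℕ.* c))
          ≤⟨ *-monoʳ (^-nonNeg (a⁻ ℕ.* (6 ℕ.* c)) 0≤Q) (^-mono (6 ℕ.* b) (*-nonNeg (^-nonNeg c 0≤w) (^-nonNeg 3 0≤lower-term)) cubed) ⟩
        (π ^ℚ c * upper-term ^ℚ 3) ^ℚ (6 ℕ.* b) * Q ^ℚ (a⁻ ℕ.* (6 ℕ.* c))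
          ≡⟨ cong (_* Q ^ℚ (a⁻ ℕ.* (6 ℕ.* c))) (trans (cong (λ u → (π ^ℚ c * u) ^ℚ (6 ℕ.* b)) (^-assocʳ Q d⁻ 3))
               (trans (^-*-^ π Q c (d⁻ ℕ.* 3) (6 ℕ.* b)) (cong (_* Q ^ℚ ((d⁻ ℕ.* 3) ℕ.* (6 ℕ.* b)))
                 (trans (cong (π ^ℚ_) (eq b c)) (sym (^-assocʳ π 2 (3 ℕ.* (b ℕ.* c)))))))) ⟩
        (π ^ℚ 2) ^ℚ (3 ℕ.* (b ℕ.* c)) * Q ^ℚ ((d⁻ ℕ.* 3) ℕ.* (6 ℕ.* b)) * Q ^ℚ (a⁻ ℕ.* (6 ℕ.* c))
          ≤⟨ *-monoʳ (^-nonNeg (a⁻ ℕ.* (6 ℕ.* c)) 0≤Q) (*-monoʳ (^-nonNeg ((d⁻ ℕ.* 3) ℕ.* (6 ℕ.* b)) 0≤Q) π²-bound) ⟩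
        R ^ℚ (6 ℕ.* (b ℕ.* c)) * Q ^ℚ (22 ℕ.* (b ℕ.* c)) * Q ^ℚ ((d⁻ ℕ.* 3) ℕ.* (6 ℕ.* b)) * Q ^ℚ (a⁻ ℕ.* (6 ℕ.* c))
          ≡⟨ collect-right ⟩
        (r ^ℚ b * Q ^ℚ a⁺) ^ℚ (6 ℕ.* c) * lower-term ^ℚ (18 ℕ.* b) ∎))
      where
      open ≤-Reasoning
      eq : ∀ b c → c ℕ.* (6 ℕ.* b) ≡ 2 ℕ.* (3 ℕ.* (b ℕ.* c))
      eq = solve-∀

-- The linear relation between the two rational exponents.

module RationalExponents where
  open import Defs using (_⁺; _⁻)
  open import Data.Integer.Base as ℤ using (ℤ; +_; -[1+_]; +0; +[1+_])
  import Data.Integer.Properties as ℤ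
  open import Data.Integer.Tactic.RingSolver using (solve-∀)
  open import Data.Nat.Base as ℕ using (ℕ; zero; suc)
  open import Data.Rational.Base
  open import Data.Rational.Properties
  open import Data.Rational.Solver using (module +-*-Solver)
  import Data.Rational.Unnormalised.Base as ℚᵘ
  import Data.Rational.Unnormalised.Properties as ℚᵘ
  open import Relation.Binary.PropositionalEquality

  i≡i⁺-i⁻ : ∀ i → i ≡ + (i ⁺) ℤ.- + (i ⁻)
  i≡i⁺-i⁻ +0       = refl
  i≡i⁺-i⁻ +[1+ n ] = sym (ℤ.+-identityʳ +[1+ n ])
  i≡i⁺-i⁻ -[1+ n ] = refl

  -- To bound the complement by q ^ s, the hypotheses are used with the exponent t given by s + 3 t = 11/3.
  partner : ℚ → ℚ
  partner s = + 8 / 9 + + 1 / 3 * (- (- 1ℚ + s))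

  s+3partner : ∀ s → s + + 3 / 1 * partner s ≡ + 11 / 3
  s+3partner = solve 1 (λ s → s :+ con (+ 3 / 1) :* (con (+ 8 / 9) :+ con (+ 1 / 3) :* (:- (:- con 1ℚ :+ s))) := con (+ 11 / 3)) refl
    where open +-*-Solver

  -- Among unnormalised rationals equality means equality of cross products, so `eq` is moved there;
  -- the factor `1 ℕ.* suc c` is the denominator of 3 t.
  cross-multiply : ∀ s t → s + + 3 / 1 * t ≡ + 11 / 3 →
                   (↥ s ℤ.* ↧ t ℤ.+ + 3 ℤ.* ↥ t ℤ.* ↧ s) ℤ.* + 3 ≡ + 11 ℤ.* (↧ s ℤ.* ↧ t)
  cross-multiply s@(mkℚ a b _) t@(mkℚ d c _) eq = begin
    (a ℤ.* + suc c ℤ.+ + 3 ℤ.* d ℤ.* + suc b) ℤ.* + 3               ≡⟨ cong (λ i → (a ℤ.* i ℤ.+ + 3 ℤ.* d ℤ.* + suc b) ℤ.* + 3) 1*c ⟨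
    (a ℤ.* + (1 ℕ.* suc c) ℤ.+ + 3 ℤ.* d ℤ.* + suc b) ℤ.* + 3       ≡⟨ ℚᵘ.drop-*≡* unnormalised ⟩
    + 11 ℤ.* + (suc b ℕ.* (1 ℕ.* suc c))                            ≡⟨ cong (+ 11 ℤ.*_) (trans (ℤ.pos-* (suc b) (1 ℕ.* suc c)) (cong (+ suc b ℤ.*_) 1*c)) ⟩
    + 11 ℤ.* (+ suc b ℤ.* + suc c)                                  ∎
    where
    open ≡-Reasoning
    1*c : + (1 ℕ.* suc c) ≡ + suc c
    1*c = trans (ℤ.pos-* 1 (suc c)) (ℤ.*-identityˡ (+ suc c))
    unnormalised : toℚᵘ s ℚᵘ.+ ℚᵘ.mkℚᵘ (+ 3) 0 ℚᵘ.* toℚᵘ t ℚᵘ.≃ ℚᵘ.mkℚᵘ (+ 11) 2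
    unnormalised = ℚᵘ.≃-trans
      (ℚᵘ.≃-sym (ℚᵘ.≃-trans (toℚᵘ-homo-+ s (+ 3 / 1 * t)) (ℚᵘ.+-congʳ (toℚᵘ s) (toℚᵘ-homo-* (+ 3 / 1) t))))
      (ℚᵘ.≃-reflexive (cong toℚᵘ eq))

  -- The equation multiplied by three times both denominators. Moving the negative parts of the
  -- numerators across leaves an identity of natural numbers, which can serve as an identity of
  -- exponents.
  clear-signs : ∀ s t → s + + 3 / 1 * t ≡ + 11 / 3 →
                3 ℕ.* ((↥ s) ⁺ ℕ.* ↧ₙ t) ℕ.+ 9 ℕ.* ((↥ t) ⁺ ℕ.* ↧ₙ s) ≡
                11 ℕ.* (↧ₙ s ℕ.* ↧ₙ t) ℕ.+ 3 ℕ.* ((↥ s) ⁻ ℕ.* ↧ₙ t) ℕ.+ 9 ℕ.* ((↥ t) ⁻ ℕ.* ↧ₙ s)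
  clear-signs s t eq = ℤ.+-injective (begin
    + (3 ℕ.* (a⁺ ℕ.* c) ℕ.+ 9 ℕ.* (d⁺ ℕ.* b))
      ≡⟨ cong₂ ℤ._+_ (pos-*₃ 3 a⁺ c) (pos-*₃ 9 d⁺ b) ⟩
    + 3 ℤ.* (+ a⁺ ℤ.* + c) ℤ.+ + 9 ℤ.* (+ d⁺ ℤ.* + b)
      ≡⟨ regroup (+ a⁺) (+ a⁻) (+ b) (+ c) (+ d⁺) (+ d⁻) ⟩
    ((+ a⁺ ℤ.- + a⁻) ℤ.* + c ℤ.+ + 3 ℤ.* (+ d⁺ ℤ.- + d⁻) ℤ.* + b) ℤ.* + 3 ℤ.+ negatives
      ≡⟨ cong (ℤ._+ negatives) (trans (cong₂ (λ i j → (i ℤ.* + c ℤ.+ + 3 ℤ.* j ℤ.* + b) ℤ.* + 3) (sym (i≡i⁺-i⁻ (↥ s))) (sym (i≡i⁺-i⁻ (↥ t)))) (cross-multiply s t eq)) ⟩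
    + 11 ℤ.* (+ b ℤ.* + c) ℤ.+ negatives
      ≡⟨ ℤ.+-assoc (+ 11 ℤ.* (+ b ℤ.* + c)) (+ 3 ℤ.* (+ a⁻ ℤ.* + c)) (+ 9 ℤ.* (+ d⁻ ℤ.* + b)) ⟨
    + 11 ℤ.* (+ b ℤ.* + c) ℤ.+ + 3 ℤ.* (+ a⁻ ℤ.* + c) ℤ.+ + 9 ℤ.* (+ d⁻ ℤ.* + b)
      ≡⟨ cong₂ ℤ._+_ (cong₂ ℤ._+_ (pos-*₃ 11 b c) (pos-*₃ 3 a⁻ c)) (pos-*₃ 9 d⁻ b) ⟨
    + (11 ℕ.* (b ℕ.* c) ℕ.+ 3 ℕ.* (a⁻ ℕ.* c) ℕ.+ 9 ℕ.* (d⁻ ℕ.* b)) ∎)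
    where
    open ≡-Reasoning
    a⁺ a⁻ b c d⁺ d⁻ : ℕ
    a⁺ = (↥ s) ⁺
    a⁻ = (↥ s) ⁻
    b  = ↧ₙ s
    c  = ↧ₙ t
    d⁺ = (↥ t) ⁺
    d⁻ = (↥ t) ⁻
    negatives : ℤ
    negatives = + 3 ℤ.* (+ a⁻ ℤ.* + c) ℤ.+ + 9 ℤ.* (+ d⁻ ℤ.* + b)
    pos-*₃ : ∀ l m n → + (l ℕ.* (m ℕ.* n)) ≡ + l ℤ.* (+ m ℤ.* + n)
    pos-*₃ l m n = trans (ℤ.pos-* l (m ℕ.* n)) (cong (+ l ℤ.*_) (ℤ.pos-* m n))
    regroup : ∀ a a′ b c d d′ → + 3 ℤ.* (a ℤ.* c) ℤ.+ + 9 ℤ.* (d ℤ.* b) ≡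
              ((a ℤ.- a′) ℤ.* c ℤ.+ + 3 ℤ.* (d ℤ.- d′) ℤ.* b) ℤ.* + 3 ℤ.+
              (+ 3 ℤ.* (a′ ℤ.* c) ℤ.+ + 9 ℤ.* (d′ ℤ.* b))
    regroup = solve-∀

-- Rational numbers as Dedekind cuts.

module ConstantReal where
  open import Defs using (ℝ)
  open import Data.Product.Base using (_,_)
  open import Data.Rational.Base
  open import Data.Rational.Properties
  open import Data.Sum.Base using (_⊎_; inj₁; inj₂)
  open import Relation.Binary.PropositionalEquality using (subst)
  open import Relation.Nullary using (yes; no)

  fromℚ : ℚ → ℝ
  fromℚ x = record
    { lower           = _< x
    ; upper           = x <_
    ; lower-inhabited = x - 1ℚ , subst (x - 1ℚ <_) (+-identityʳ x) (+-monoʳ-< x (negative⁻¹ (- 1ℚ)))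
    ; upper-inhabited = x + 1ℚ , subst (_< x + 1ℚ) (+-identityʳ x) (+-monoʳ-< x (positive⁻¹ 1ℚ))
    ; lower-closed    = <-trans
    ; upper-closed    = λ r<s x<r → <-trans x<r r<s
    ; lower-open      = <-dense
    ; upper-open      = λ x<s → let r , x<r , r<s = <-dense x<s in r , r<s , x<r
    ; disjoint        = <-asym
    ; located         = λ {r} {s} → located
    }
    where
    located : ∀ {r s} → r < s → r < x ⊎ x < s
    located {r} r<s with r <? x
    ... | yes r<x = inj₁ r<x
    ... | no  r≮x = inj₂ (≤-<-trans (≮⇒≥ r≮x) r<s)

-- From the bound in natural numbers to comparisons with rational powers of q.

module Comparison where
  open import Defs using (fromℕ; _^ℚ_)
  open import Data.Integer.Base using (+_)
  open import Data.Nat.Base as ℕ using (ℕ)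
  open import Data.Rational.Base
  open import Data.Rational.Properties
  open import Relation.Binary.PropositionalEquality
  open RationalPowers

  fromℕ-monomial : ∀ x q i j → fromℕ (x ℕ.^ i ℕ.* q ℕ.^ j) ≡ fromℕ x ^ℚ i * fromℕ q ^ℚ j
  fromℕ-monomial x q i j = trans (fromℕ-* (x ℕ.^ i) (q ℕ.^ j)) (cong₂ _*_ (fromℕ-^ x i) (fromℕ-^ q j))

  fromℕ-product : ∀ x y z w → fromℕ (x ℕ.* y ℕ.* z ℕ.* w) ≡ fromℕ x * fromℕ y * fromℕ z * fromℕ w
  fromℕ-product x y z w = trans (fromℕ-* (x ℕ.* y ℕ.* z) w) (cong (_* fromℕ w)
    (trans (fromℕ-* (x ℕ.* y) z) (cong (_* fromℕ z) (fromℕ-* x y))))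

  -- With K = k the left side of the hypothesis is the constant C of the theorem, and r is an
  -- arbitrary rational above it.
  clear-cubes : ∀ {K ρ r} .{{_ : NonZero ρ}} → 0ℚ < ρ → K * (1/ ρ) ^ℚ 3 < r → K ≤ r * ρ ^ℚ 3
  clear-cubes {K} {ρ} {r} 0<ρ Kσ³<r = begin
    K                             ≡⟨ *-identityʳ K ⟨
    K * 1ℚ                        ≡⟨ cong (λ a → K * a ^ℚ 3) (*-inverseˡ ρ) ⟨
    K * (1/ ρ * ρ) ^ℚ 3           ≡⟨ cong (K *_) (^-distrib-* (1/ ρ) ρ 3) ⟩
    K * ((1/ ρ) ^ℚ 3 * ρ ^ℚ 3)    ≡⟨ *-assoc K ((1/ ρ) ^ℚ 3) (ρ ^ℚ 3) ⟨
    K * (1/ ρ) ^ℚ 3 * ρ ^ℚ 3      ≤⟨ *-monoʳ (^-nonNeg 3 (<⇒≤ 0<ρ)) (<⇒≤ Kσ³<r) ⟩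
    r * ρ ^ℚ 3                    ∎
    where open ≤-Reasoning

  module _ {q k x y z w : ℕ} {ρ r : ℚ} (1≤q : 1 ℕ.≤ q) (0<ρ : 0ℚ < ρ) (0<r : 0ℚ < r)
           (k≤ : fromℕ k ≤ r * ρ ^ℚ 3)
           (product≤ : (x ℕ.* y ℕ.* z ℕ.* w) ℕ.^ 2 ℕ.≤ k ℕ.^ 2 ℕ.* q ℕ.^ 7) where
    open import Defs using ([_·_^_]≤ℚ_; _≤ℚ[_·_^_]; _⁺; _⁻)
    open RationalExponents

    complement-rational-bound : ∀ s t → s + + 3 / 1 * t ≡ + 11 / 3 →
      [ ρ · q ^ t ]≤ℚ x → [ ρ · q ^ t ]≤ℚ y → [ ρ · q ^ t ]≤ℚ z → w ≤ℚ[ r · q ^ s ]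
    complement-rational-bound s t eq x≥ y≥ z≥ = subst₂ _≤_
      (sym (fromℕ-monomial w q b a⁻)) (cong (r ^ℚ b *_) (sym (fromℕ-^ q a⁺)))
      (complement-power-bound {w = fromℕ w} (fromℕ-mono {1} 1≤q) (fromℕ-nonNeg k) (fromℕ-nonNeg x)
        (fromℕ-nonNeg y) (fromℕ-nonNeg z) (fromℕ-nonNeg w) 0<ρ 0<r k≤
        (subst₂ _≤_ (trans (fromℕ-^ (x ℕ.* y ℕ.* z ℕ.* w) 2) (cong (_^ℚ 2) (fromℕ-product x y z w)))
          (fromℕ-monomial k q 2 7) (fromℕ-mono product≤))
        b c a⁺ a⁻ d⁺ d⁻ (clear-signs s t eq) (power x x≥) (power y y≥) (power z z≥))
      where
      b c a⁺ a⁻ d⁺ d⁻ : ℕ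
      b  = ↧ₙ s
      c  = ↧ₙ t
      a⁺ = (↥ s) ⁺
      a⁻ = (↥ s) ⁻
      d⁺ = (↥ t) ⁺
      d⁻ = (↥ t) ⁻
      power : ∀ u → [ ρ · q ^ t ]≤ℚ u → ρ ^ℚ c * fromℕ q ^ℚ d⁺ ≤ fromℕ u ^ℚ c * fromℕ q ^ℚ d⁻
      power u = subst₂ _≤_ (cong (ρ ^ℚ c *_) (fromℕ-^ q d⁺)) (fromℕ-monomial u q c d⁻)

open import Algebra.Apartness.Bundles using (HeytingField)
open import Algebra.Core using (Op₁; Op₂)
open import Algebra.Morphism.Structures using (IsRingMonomorphism)
import Algebra.Morphism.RingMonomorphism as RingMonomorphism
open import Algebra.Structures using (IsCommutativeRing)
open import Data.Fin.Base using (Fin)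
open import Data.Fin.Permutation using (Permutation; permutation)
import Data.Fin.Properties as Fin
open import Data.Fin.Subset using (Subset; _∈_; _∉_; ∁; ∣_∣)
open import Data.Fin.Subset.Properties using (_∈?_; x∈∁p⇒x∉p; ∣p∣≤n; ∣∁p∣≡n∸∣p∣)
open import Data.Integer.Base using (ℤ; +_; +≤+; 0ℤ; 1ℤ; Positive; nonNegative) renaming (_+_ to _+ᶻ_; _*_ to _*ᶻ_; _-_ to _-ᶻ_; _≤_ to _≤ᶻ_; -_ to -ᶻ_)
import Data.Integer.Properties as ℤ
open import Data.Integer.Tactic.RingSolver using (solve-∀)
open import Data.Nat.Base as ℕ using (ℕ; zero; suc)
open import Data.Nat.Coprimality using (coprime-Bézout; prime⇒coprime)
open import Data.Nat.GCD using (module Bézout)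
open import Data.Nat.Primality using (Prime; prime⇒nonZero)
import Data.Nat.Properties as ℕ
open import Data.Product.Base using (∃-syntax; _×_; _,_; proj₁; proj₂)
open import Data.Sum.Base using (_⊎_; inj₁; inj₂)
open import Data.Vec.Properties using (lookup⇒[]=; lookup∘tabulate)
open import Defs using (FiniteField; module FiniteField)
open import Function.Base using (_∘_)
open import Function.Bundles using (Inverse)
open import Level using (0ℓ)
open import Relation.Binary.PropositionalEquality using (_≡_; _≢_; refl; sym; trans; cong; cong₂; subst; subst₂; module ≡-Reasoning)
open import Relation.Nullary using (¬_; yes; no; contradiction; does)
open import Relation.Nullary.Decidable using (dec-true)

-- Fields on `Fin q`, polynomials and the sizes of their fibres.

-- The elements are the indices themselves, under propositional equality: a sum over the field is
-- then a sum over `Fin q`, and every equation between elements can be decided.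
record IsField {q} (_+_ _*_ : Op₂ (Fin q)) (-_ : Op₁ (Fin q)) (0# 1# : Fin q) : Set where
  field
    isCommutativeRing : IsCommutativeRing _≡_ _+_ _*_ -_ 0# 1#
    inverse           : ∀ {x} → x ≢ 0# → ∃[ y ] x * y ≡ 1#
    1≢0               : 1# ≢ 0#

module FieldTheory {q} {_+_ _*_ : Op₂ (Fin q)} { -_ : Op₁ (Fin q)} {0# 1# : Fin q}
                   (isField : IsField _+_ _*_ -_ 0# 1#) where
  open IntegerSums
  open IsField isField

  F : CommutativeRing 0ℓ 0ℓ
  F = record { isCommutativeRing = isCommutativeRing }

  open CommutativeRing F public
    using (+-commutativeMonoid; +-comm; +-identityʳ; -‿inverseʳ; semiring;
           *-comm; *-assoc; *-identityˡ; zeroˡ; zeroʳ; _-_)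
  open CommutativeRing F using (ring)
  open import Algebra.Properties.Ring ring using (x∙y⁻¹≈ε⇒x≈y)
  open import Algebra.Properties.Semiring.Exp semiring public using (_^_)
  open import Algebra.Properties.Semiring.Mult semiring public using (×1-homo-*) renaming (_×_ to _·_)
  open IntegerCoefficients F public using (solve; _:=_; _:+_; _:*_; _:-_; :-_; con)

  x*y≡0⇒y≡0 : ∀ {x y} → x ≢ 0# → x * y ≡ 0# → y ≡ 0#
  x*y≡0⇒y≡0 {x} {y} x≢0 x*y≡0 with z , x*z≡1 ← inverse x≢0 = begin
    y            ≡⟨ *-identityˡ y ⟨
    1# * y       ≡⟨ cong (_* y) x*z≡1 ⟨
    (x * z) * y  ≡⟨ solve 3 (λ x y z → (x :* z) :* y := z :* (x :* y)) refl x y z ⟩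
    z * (x * y)  ≡⟨ cong (z *_) x*y≡0 ⟩
    z * 0#       ≡⟨ zeroʳ z ⟩
    0#           ∎
    where open ≡-Reasoning

  x-y≢0 : ∀ {x y} → x ≢ y → x - y ≢ 0#
  x-y≢0 {x} {y} x≢y x-y≡0 = x≢y (x∙y⁻¹≈ε⇒x≈y x y x-y≡0)

  -- IsPolynomial n a g: the function g is given by a polynomial of degree at
  -- most n whose coefficient of degree n is a.  Only the factor theorem is
  -- needed, so it serves as the definition.
  IsPolynomial : ℕ → Fin q → (Fin q → Fin q) → Set
  IsPolynomial zero    a g = ∀ v → g v ≡ a
  IsPolynomial (suc n) a g =
    ∀ r → ∃[ h ] IsPolynomial n a h × (∀ v → g v - g r ≡ (v - r) * h v)

  poly-cong : ∀ n {a b g h} → a ≡ b → (∀ v → g v ≡ h v) → IsPolynomial n a g → IsPolynomial n b h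
  poly-cong zero    a≡b g≗h p v = trans (sym (g≗h v)) (trans (p v) a≡b)
  poly-cong (suc n) refl g≗h p r with g′ , p′ , eq ← p r =
    g′ , p′ , λ v → trans (cong₂ _-_ (sym (g≗h v)) (sym (g≗h r))) (eq v)

  poly-+ : ∀ n {a b g h} → IsPolynomial n a g → IsPolynomial n b h →
           IsPolynomial n (a + b) (λ v → g v + h v)
  poly-+ zero    p p′ v = cong₂ _+_ (p v) (p′ v)
  poly-+ (suc n) {g = g} {h} p p′ r with g₁ , p₁ , eq₁ ← p r | h₁ , p₁′ , eq₁′ ← p′ r =
    (λ v → g₁ v + h₁ v) , poly-+ n p₁ p₁′ , λ v → begin
      (g v + h v) - (g r + h r)             ≡⟨ solve 4 (λ a b c d → (a :+ b) :- (c :+ d) := (a :- c) :+ (b :- d)) refl (g v) (h v) (g r) (h r) ⟩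
      (g v - g r) + (h v - h r)             ≡⟨ cong₂ _+_ (eq₁ v) (eq₁′ v) ⟩
      ((v - r) * g₁ v) + ((v - r) * h₁ v)   ≡⟨ solve 3 (λ x a b → (x :* a) :+ (x :* b) := x :* (a :+ b)) refl (v - r) (g₁ v) (h₁ v) ⟩
      (v - r) * (g₁ v + h₁ v)               ∎
    where open ≡-Reasoning

  poly-scale : ∀ n c {a g} → IsPolynomial n a g → IsPolynomial n (c * a) (λ v → c * g v)
  poly-scale zero    c p v = cong (c *_) (p v)
  poly-scale (suc n) c {g = g} p r with g₁ , p₁ , eq₁ ← p r =
    (λ v → c * g₁ v) , poly-scale n c p₁ , λ v → begin
      (c * g v) - (c * g r)   ≡⟨ solve 3 (λ c a b → (c :* a) :- (c :* b) := c :* (a :- b)) refl c (g v) (g r) ⟩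
      c * (g v - g r)         ≡⟨ cong (c *_) (eq₁ v) ⟩
      c * ((v - r) * g₁ v)    ≡⟨ solve 3 (λ c x a → c :* (x :* a) := x :* (c :* a)) refl c (v - r) (g₁ v) ⟩
      (v - r) * (c * g₁ v)    ∎
    where open ≡-Reasoning

  -- `poly-+` adds polynomials of the same formal degree; a summand of lower degree is first padded
  -- with the leading coefficient zero.
  poly-raise : ∀ n {a g} → IsPolynomial n a g → IsPolynomial (suc n) 0# g
  poly-raise zero    p r = (λ _ → 0#) , (λ _ → refl) , λ v →
    trans (cong₂ _-_ (p v) (p r)) (trans (-‿inverseʳ _) (sym (zeroʳ _)))
  poly-raise (suc n) p r with g₁ , p₁ , eq₁ ← p r = g₁ , poly-raise n p₁ , eq₁

  -- A discrete product rule: the difference of (v - c) g v between v and r is (v - r) g v + (r -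
  -- c)(g v - g r). The quotient is thus g plus a term of lower degree, and the leading coefficient
  -- is unchanged.
  poly-linear-* : ∀ n c {a g} → IsPolynomial n a g → IsPolynomial (suc n) a (λ v → (v - c) * g v)
  poly-linear-* zero c {a} {g} p r = g , p , λ v → begin
    ((v - c) * g v) - ((r - c) * g r)   ≡⟨ cong (λ x → ((v - c) * g v) - ((r - c) * x)) (trans (p r) (sym (p v))) ⟩
    ((v - c) * g v) - ((r - c) * g v)   ≡⟨ solve 4 (λ v c r x → ((v :- c) :* x) :- ((r :- c) :* x) := (v :- r) :* x) refl v c r (g v) ⟩
    (v - r) * g v                       ∎
    where open ≡-Reasoning
  poly-linear-* (suc n) c {a} {g} p r with g₁ , p₁ , eq₁ ← p r =
    (λ v → g v + ((r - c) * g₁ v)) ,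
    poly-cong (suc n) (+-identityʳ a) (λ _ → refl)
      (poly-+ (suc n) p (poly-raise n (poly-scale n (r - c) p₁))) ,
    λ v → begin
      ((v - c) * g v) - ((r - c) * g r)
        ≡⟨ solve 5 (λ v c r x y → ((v :- c) :* x) :- ((r :- c) :* y) := ((v :- r) :* x) :+ ((r :- c) :* (x :- y))) refl v c r (g v) (g r) ⟩
      ((v - r) * g v) + ((r - c) * (g v - g r))
        ≡⟨ cong (λ x → ((v - r) * g v) + ((r - c) * x)) (eq₁ v) ⟩
      ((v - r) * g v) + ((r - c) * ((v - r) * g₁ v))
        ≡⟨ solve 4 (λ d x e y → (d :* x) :+ (e :* (d :* y)) := d :* (x :+ (e :* y))) refl (v - r) (g v) (r - c) (g₁ v) ⟩
      (v - r) * (g v + ((r - c) * g₁ v))    ∎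
    where open ≡-Reasoning

  poly-^ : ∀ n → IsPolynomial n 1# (_^ n)
  poly-^ zero    v = refl
  poly-^ (suc n) = poly-cong (suc n) refl
    (λ v → solve 2 (λ v x → (v :- con (+ 0)) :* x := v :* x) refl v (v ^ n))
    (poly-linear-* n 0# (poly-^ n))

  σ : ℕ → Fin q → Fin q
  σ n v = (v ^ n) - ((v - 1#) ^ n)

  -- The top terms cancel, so the degree is one less than the power. Writing v = 1 + (v - 1) in the
  -- first term gives the recursion v^(n+1) + (v - 1) σ_(n+1)(v) for σ_(n+2)(v); each step adds 1 to
  -- the leading coefficient.
  poly-σ : ∀ n → IsPolynomial n (suc n · 1#) (σ (suc n))
  poly-σ zero    v = trans
    (solve 1 (λ v → (v :* con (+ 1)) :- ((v :- con (+ 1)) :* con (+ 1)) := con (+ 1)) refl v)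
    (sym (+-identityʳ 1#))
  poly-σ (suc n) = poly-cong (suc n) refl
    (λ v → solve 3 (λ v x y → x :+ ((v :- con (+ 1)) :* (x :- y)) := (v :* x) :- ((v :- con (+ 1)) :* y))
             refl v (v ^ suc n) ((v - 1#) ^ suc n))
    (poly-+ (suc n) (poly-^ (suc n)) (poly-linear-* n 1# (poly-σ n)))

  private
    δ-∣ : ∀ {a b c d e f : Fin q} → (a ≡ b → c ≡ d ⊎ e ≡ f) → δ a b ≤ᶻ δ c d +ᶻ δ e f
    δ-∣ {a} {b} {c} {d} {e} {f} a≡b⇒ with a Fin.≟ b
    ... | no  _   = ℤ.+-mono-≤ (δ-nonNeg c d) (δ-nonNeg e f)
    ... | yes a≡b with a≡b⇒ a≡b
    ...   | inj₁ c≡d = ℤ.≤-trans (ℤ.+-monoʳ-≤ 1ℤ (δ-nonNeg e f)) (ℤ.≤-reflexive (cong (_+ᶻ δ e f) (sym (δ-≡ c≡d))))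
    ...   | inj₂ e≡f = ℤ.≤-trans (ℤ.+-monoˡ-≤ 1ℤ (δ-nonNeg c d)) (ℤ.≤-reflexive (cong (δ c d +ᶻ_) (sym (δ-≡ e≡f))))

    ∑-δ1 : ∀ (r : Fin q) → ∑[ v ] δ v r ≡ 1ℤ
    ∑-δ1 r = trans (∑-cong λ v → trans (δ-sym v r) (sym (ℤ.*-identityʳ (δ r v)))) (∑-δ r (λ _ → 1ℤ))
      where
      δ-sym : ∀ {n} (i j : Fin n) → δ i j ≡ δ j i
      δ-sym i j with i Fin.≟ j
      ... | yes i≡j = sym (δ-≡ (sym i≡j))
      ... | no  i≢j = sym (δ-≢ (i≢j ∘ sym))

    vanish : ∀ {g : Fin q → Fin q} {s} → (∀ v → g v ≢ s) → ∑[ v ] δ (g v) s ≡ 0ℤ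
    vanish g≢s = trans (∑-cong λ v → δ-≢ (g≢s v)) (trans (∑-const q 0ℤ) (ℤ.*-zeroʳ (+ q)))

  mutual
    root-bound : ∀ n {a g} → IsPolynomial n a g → a ≢ 0# → ∑[ v ] δ (g v) 0# ≤ᶻ + n
    root-bound zero    {g = g} p a≢0 = ℤ.≤-reflexive (vanish {g} λ v gv≡0 → a≢0 (trans (sym (p v)) gv≡0))
    root-bound (suc n) p a≢0 = fibre-bound n p a≢0 0#

    -- If g r = s, then any other v with g v = s is a root of the quotient h, which has degree n and
    -- the same leading coefficient. At degree zero a fibre can be the whole field, so the recursion
    -- goes through roots, where a nonzero constant has none.
    fibre-bound : ∀ n {a g} → IsPolynomial (suc n) a g → a ≢ 0# → ∀ s → ∑[ v ] δ (g v) s ≤ᶻ + suc n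
    fibre-bound n {g = g} p a≢0 s with Fin.any? (λ v → g v Fin.≟ s)
    ... | no  ∄r = ℤ.≤-trans (ℤ.≤-reflexive (vanish {g} λ v gv≡s → ∄r (v , gv≡s))) (+≤+ ℕ.z≤n)
    ... | yes (r , gr≡s) with h , p′ , eq ← p r = begin
      ∑[ v ] δ (g v) s                       ≤⟨ ∑-mono (λ v → δ-∣ (factor v)) ⟩
      ∑[ v ] (δ v r +ᶻ δ (h v) 0#)           ≡⟨ ∑-+ (λ v → δ v r) (λ v → δ (h v) 0#) ⟩
      ∑[ v ] δ v r +ᶻ ∑[ v ] δ (h v) 0#      ≤⟨ ℤ.+-mono-≤ (ℤ.≤-reflexive (∑-δ1 r)) (root-bound n p′ a≢0) ⟩
      + suc n                                ∎
      where
      open ℤ.≤-Reasoning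
      factor : ∀ v → g v ≡ s → v ≡ r ⊎ h v ≡ 0#
      factor v gv≡s with v Fin.≟ r
      ... | yes v≡r = inj₁ v≡r
      ... | no  v≢r = inj₂ (x*y≡0⇒y≡0 (x-y≢0 v≢r) (trans (sym (eq v))
                        (trans (cong₂ _-_ gv≡s gr≡s) (-‿inverseʳ s))))

  -- The v are grouped by the value g v. As φ is nonnegative, each fibre size may be replaced by its
  -- bound, and values that are not attained may be added.
  ∑-fibre-bound : ∀ n {a g} → IsPolynomial (suc n) a g → a ≢ 0# →
                  ∀ (φ : Fin q → ℤ) → (∀ s → 0ℤ ≤ᶻ φ s) → ∑[ v ] φ (g v) ≤ᶻ + suc n *ᶻ (∑[ s ] φ s)
  ∑-fibre-bound n {g = g} p a≢0 φ 0≤φ = begin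
    ∑[ v ] φ (g v)                     ≡⟨ ∑-cong (λ v → ∑-δ (g v) φ) ⟨
    ∑[ v ] ∑[ s ] δ (g v) s *ᶻ φ s     ≡⟨ ∑-comm (λ v s → δ (g v) s *ᶻ φ s) ⟩
    ∑[ s ] ∑[ v ] δ (g v) s *ᶻ φ s     ≡⟨ ∑-cong (λ s → ∑-* (λ v → δ (g v) s) (φ s)) ⟨
    ∑[ s ] (∑[ v ] δ (g v) s) *ᶻ φ s   ≤⟨ ∑-mono (λ s → *-monoʳ (0≤φ s) (fibre-bound n p a≢0 s)) ⟩
    ∑[ s ] + suc n *ᶻ φ s              ≡⟨ *-∑ (+ suc n) φ ⟨
    + suc n *ᶻ (∑[ s ] φ s)            ∎
    where open ℤ.≤-Reasoning

-- The second moment of G and the product bound.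

module Correlation {q} {_+_ _*_ : Op₂ (Fin q)} { -_ : Op₁ (Fin q)} {0# 1# : Fin q}
                   (isField : IsField _+_ _*_ -_ 0# 1#) where
  open IntegerSums
  open IsField isField
  open FieldTheory isField
  open import Algebra.Properties.CommutativeSemiring.Exp (CommutativeRing.commutativeSemiring F)
    using (^-distrib-*)

  ∑-shift : ∀ a (f : Fin q → ℤ) → ∑[ x ] f (x + a) ≡ ∑[ x ] f x
  ∑-shift a f = ∑-reindex f (_+ a) (_- a)
    (λ x → solve 2 (λ x a → (x :- a) :+ a := x) refl x a)
    (λ x → solve 2 (λ x a → (x :+ a) :- a := x) refl x a)

  ∑-reflect : ∀ a (f : Fin q → ℤ) → ∑[ x ] f (a - x) ≡ ∑[ x ] f x
  ∑-reflect a f = ∑-reindex f (λ x → a - x) (λ x → a - x) a-[a-x]≡x a-[a-x]≡x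
    where
    a-[a-x]≡x : ∀ x → a - (a - x) ≡ x
    a-[a-x]≡x x = solve 2 (λ x a → a :- (a :- x) := x) refl x a

  ∑-scale : ∀ {a} → a ≢ 0# → (f : Fin q → ℤ) → ∑[ x ] f (a * x) ≡ ∑[ x ] f x
  ∑-scale {a} a≢0 f with b , ab≡1 ← inverse a≢0 = ∑-reindex f (a *_) (b *_)
    (λ x → trans (sym (*-assoc a b x)) (trans (cong (_* x) ab≡1) (*-identityˡ x)))
    (λ x → trans (sym (*-assoc b a x)) (trans (cong (_* x) (trans (*-comm b a) ab≡1)) (*-identityˡ x)))

  ∑-comm₁₂ : ∀ {l m n} (f : Fin l → Fin m → Fin n → ℤ) →
             ∑[ i ] ∑[ s ] ∑[ t ] f i s t ≡ ∑[ s ] ∑[ t ] ∑[ i ] f i s t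
  ∑-comm₁₂ f = trans (∑-comm λ i s → ∑[ t ] f i s t) (∑-cong λ s → ∑-comm λ i t → f i s t)

  ∑-comm₂₂ : ∀ {k l m n} (f : Fin k → Fin l → Fin m → Fin n → ℤ) →
             ∑[ i ] ∑[ j ] ∑[ s ] ∑[ t ] f i j s t ≡ ∑[ s ] ∑[ t ] ∑[ i ] ∑[ j ] f i j s t
  ∑-comm₂₂ f = trans (∑-cong λ i → ∑-comm₁₂ (f i)) (∑-comm₁₂ λ i s t → ∑[ j ] f i j s t)

  ∑∑-* : ∀ {m n} (f : Fin m → Fin n → ℤ) a →
         (∑[ i ] ∑[ j ] f i j) *ᶻ a ≡ ∑[ i ] ∑[ j ] f i j *ᶻ a
  ∑∑-* f a = trans (∑-* (λ i → ∑[ j ] f i j) a) (∑-cong λ i → ∑-* (f i) a)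

  *-∑∑ : ∀ {m n} a (f : Fin m → Fin n → ℤ) →
         a *ᶻ (∑[ i ] ∑[ j ] f i j) ≡ ∑[ i ] ∑[ j ] a *ᶻ f i j
  *-∑∑ a f = trans (*-∑ a (λ i → ∑[ j ] f i j)) (∑-cong λ i → *-∑ a (f i))

  module Autocorrelation (h : Fin q → ℤ) (∑h≡0 : ∑[ z ] h z ≡ 0ℤ) where

    N : Fin q → ℤ
    N e = ∑[ z ] h z *ᶻ h (z + e)

    ∑-N : ∑[ e ] N e ≡ 0ℤ
    ∑-N = begin
      ∑[ e ] ∑[ z ] h z *ᶻ h (z + e)     ≡⟨ ∑-comm (λ e z → h z *ᶻ h (z + e)) ⟩
      ∑[ z ] ∑[ e ] h z *ᶻ h (z + e)     ≡⟨ ∑-cong (λ z → *-∑ (h z) (λ e → h (z + e))) ⟨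
      ∑[ z ] h z *ᶻ (∑[ e ] h (z + e))   ≡⟨ ∑-cong (λ z → cong (h z *ᶻ_) (trans (∑-cong λ e → cong h (+-comm z e)) (trans (∑-shift z h) ∑h≡0))) ⟩
      ∑[ z ] h z *ᶻ 0ℤ                   ≡⟨ ∑-* h 0ℤ ⟨
      (∑[ z ] h z) *ᶻ 0ℤ                 ≡⟨ ℤ.*-zeroʳ (∑[ z ] h z) ⟩
      0ℤ                                 ∎
      where open ≡-Reasoning

    ∑-translates : ∀ a b → ∑[ w ] h (w + a) *ᶻ h (w + b) ≡ N (b - a)
    ∑-translates a b = begin
      ∑[ w ] h (w + a) *ᶻ h (w + b)                         ≡⟨ ∑-shift (- a) (λ w → h (w + a) *ᶻ h (w + b)) ⟨
      ∑[ w ] h ((w + (- a)) + a) *ᶻ h ((w + (- a)) + b)     ≡⟨ ∑-cong (λ w → cong₂ (λ x y → h x *ᶻ h y)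
          (solve 2 (λ w a → (w :+ (:- a)) :+ a := w) refl w a)
          (solve 3 (λ w a b → (w :+ (:- a)) :+ b := w :+ (b :- a)) refl w a b)) ⟩
      N (b - a)                                             ∎
      where open ≡-Reasoning

    V : Fin q → Fin q → ℤ
    V t u = ∑[ s ] N (t * s) *ᶻ N (u * s)

    -- For s nonzero, u ↦ u s permutes the field, and the sum over u vanishes by `∑-N`. Only s = 0
    -- remains, where all q terms of that sum are N(0).
    ∑-V : ∀ t → ∑[ u ] V t u ≡ + q *ᶻ (N 0# *ᶻ N 0#)
    ∑-V t = begin
      ∑[ u ] ∑[ s ] N (t * s) *ᶻ N (u * s)        ≡⟨ ∑-comm (λ u s → N (t * s) *ᶻ N (u * s)) ⟩
      ∑[ s ] ∑[ u ] N (t * s) *ᶻ N (u * s)        ≡⟨ ∑-cong (λ s → *-∑ (N (t * s)) (λ u → N (u * s))) ⟨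
      ∑[ s ] N (t * s) *ᶻ (∑[ u ] N (u * s))      ≡⟨ ∑-cong inner ⟩
      ∑[ s ] δ 0# s *ᶻ (N (t * s) *ᶻ (+ q *ᶻ N 0#)) ≡⟨ ∑-δ 0# (λ s → N (t * s) *ᶻ (+ q *ᶻ N 0#)) ⟩
      N (t * 0#) *ᶻ (+ q *ᶻ N 0#)                 ≡⟨ cong (λ e → N e *ᶻ (+ q *ᶻ N 0#)) (zeroʳ t) ⟩
      N 0# *ᶻ (+ q *ᶻ N 0#)                       ≡⟨ rearrange (+ q) (N 0#) ⟩
      + q *ᶻ (N 0# *ᶻ N 0#)                       ∎
      where
      open ≡-Reasoning
      rearrange : ∀ a b → b *ᶻ (a *ᶻ b) ≡ a *ᶻ (b *ᶻ b)
      rearrange = solve-∀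
      inner : ∀ s → N (t * s) *ᶻ (∑[ u ] N (u * s)) ≡ δ 0# s *ᶻ (N (t * s) *ᶻ (+ q *ᶻ N 0#))
      inner s with s Fin.≟ 0#
      ... | yes refl = trans
        (cong (N (t * s) *ᶻ_) (trans (∑-cong λ u → cong N (zeroʳ u)) (∑-const q (N 0#))))
        (sym (trans (cong (_*ᶻ (N (t * s) *ᶻ (+ q *ᶻ N 0#))) (δ-≡ {i = 0#} refl)) (ℤ.*-identityˡ _)))
      ... | no s≢0 = trans
        (cong (N (t * s) *ᶻ_) (trans (∑-cong λ u → cong N (*-comm u s)) (trans (∑-scale s≢0 N) ∑-N)))
        (trans (ℤ.*-zeroʳ (N (t * s)))
          (sym (trans (cong (_*ᶻ (N (t * s) *ᶻ (+ q *ᶻ N 0#))) (δ-≢ (s≢0 ∘ sym))) (ℤ.*-zeroˡ (N (t * s) *ᶻ (+ q *ᶻ N 0#))))))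

    -- Up to the factor q, V t u is the sum of the squares of the sums of
    -- h ⊗ h over all lines of direction (t , u).
    q*V : ∀ t u → + q *ᶻ V t u ≡ ∑[ z ] ∑[ w ] ((∑[ s ] h (z + (t * s)) *ᶻ h (w + (u * s))) *ᶻ
                                               (∑[ s ] h (z + (t * s)) *ᶻ h (w + (u * s))))
    q*V t u = sym (begin
      ∑[ z ] ∑[ w ] ((∑[ s ] a z w s) *ᶻ (∑[ s ] a z w s))
        ≡⟨ ∑-cong (λ z → ∑-cong λ w → ∑-*-∑ (a z w) (a z w)) ⟩
      ∑[ z ] ∑[ w ] ∑[ r ] ∑[ s ] a z w r *ᶻ a z w s
        ≡⟨ ∑-comm₂₂ (λ z w r s → a z w r *ᶻ a z w s) ⟩
      ∑[ r ] ∑[ s ] ∑[ z ] ∑[ w ] a z w r *ᶻ a z w s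
        ≡⟨ ∑-cong (λ r → ∑-cong λ s → inner r s) ⟩
      ∑[ r ] ∑[ s ] N (t * (s - r)) *ᶻ N (u * (s - r))
        ≡⟨ ∑-cong (λ r → ∑-shift (- r) (λ s → N (t * s) *ᶻ N (u * s))) ⟩
      ∑[ r ] (λ (_ : Fin q) → V t u) r
        ≡⟨ ∑-const q (V t u) ⟩
      + q *ᶻ V t u ∎)
      where
      open ≡-Reasoning
      a : Fin q → Fin q → Fin q → ℤ
      a z w s = h (z + (t * s)) *ᶻ h (w + (u * s))
      interchange : ∀ a b c d → (a *ᶻ b) *ᶻ (c *ᶻ d) ≡ (a *ᶻ c) *ᶻ (b *ᶻ d)
      interchange = solve-∀
      factor : ∀ t r s → (t * s) - (t * r) ≡ t * (s - r)
      factor = solve 3 (λ t r s → (t :* s) :- (t :* r) := t :* (s :- r)) refl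
      inner : ∀ r s → ∑[ z ] ∑[ w ] a z w r *ᶻ a z w s ≡ N (t * (s - r)) *ᶻ N (u * (s - r))
      inner r s = begin
        ∑[ z ] ∑[ w ] a z w r *ᶻ a z w s
          ≡⟨ ∑-cong (λ z → ∑-cong λ w → interchange (h (z + (t * r))) (h (w + (u * r))) (h (z + (t * s))) (h (w + (u * s)))) ⟩
        ∑[ z ] ∑[ w ] (h (z + (t * r)) *ᶻ h (z + (t * s))) *ᶻ (h (w + (u * r)) *ᶻ h (w + (u * s)))
          ≡⟨ ∑-*-∑ (λ z → h (z + (t * r)) *ᶻ h (z + (t * s))) (λ w → h (w + (u * r)) *ᶻ h (w + (u * s))) ⟨
        (∑[ z ] h (z + (t * r)) *ᶻ h (z + (t * s))) *ᶻ (∑[ w ] h (w + (u * r)) *ᶻ h (w + (u * s)))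
          ≡⟨ cong₂ _*ᶻ_ (∑-translates (t * r) (t * s)) (∑-translates (u * r) (u * s)) ⟩
        N ((t * s) - (t * r)) *ᶻ N ((u * s) - (u * r))
          ≡⟨ cong₂ (λ x y → N x *ᶻ N y) (factor t r s) (factor u r s) ⟩
        N (t * (s - r)) *ᶻ N (u * (s - r)) ∎

    V-nonNeg : ∀ t u → 0ℤ ≤ᶻ V t u
    V-nonNeg t u = ℤ.*-cancelˡ-≤-pos 0ℤ (V t u) (+ q) {{positive t}} (begin
      + q *ᶻ 0ℤ      ≡⟨ ℤ.*-zeroʳ (+ q) ⟩
      0ℤ             ≤⟨ ∑-nonNeg (λ z → ∑-nonNeg λ w → square-nonNeg (∑[ s ] h (z + (t * s)) *ᶻ h (w + (u * s)))) ⟩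
      _              ≡⟨ q*V t u ⟨
      + q *ᶻ V t u   ∎)
      where
      open ℤ.≤-Reasoning
      -- The factor q can be cancelled because the point `t` of `Fin q` shows that q is not zero.
      positive : ∀ {n} → Fin n → Positive (+ n)
      positive {suc n} _ = _

    module Energy (m : ℕ) (k≢0 : (suc (suc m)) · 1# ≢ 0#)
                  (f : Fin q → ℤ) (0≤f : ∀ x → 0ℤ ≤ᶻ f x) (f≤1 : ∀ x → f x ≤ᶻ 1ℤ) where

      k : ℕ
      k = suc (suc m)

      ∣f∣ N₀ : ℤ
      ∣f∣ = ∑[ x ] f x
      N₀ = N 0#

      D : Fin q → ℤ
      D s = ∑[ x ] ∑[ y ] (f x *ᶻ f y) *ᶻ N (((x - y) ^ k) * s)

      bound : ℤ
      bound = + k *ᶻ (+ q *ᶻ (N₀ *ᶻ N₀))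

      -- Since V is nonnegative, the weight f y may be raised to 1. Then x - y runs over the whole
      -- field, its k-th power takes each value at most k times, and the total of V over all
      -- directions applies: one of the two sums over f is saved.
      ∑-N*D : ∀ t → ∑[ s ] N (t * s) *ᶻ D s ≤ᶻ ∣f∣ *ᶻ bound
      ∑-N*D t = begin
        ∑[ s ] N (t * s) *ᶻ D s
          ≡⟨ ∑-cong (λ s → *-∑∑ (N (t * s)) (λ x y → (f x *ᶻ f y) *ᶻ N (((x - y) ^ k) * s))) ⟩
        ∑[ s ] ∑[ x ] ∑[ y ] N (t * s) *ᶻ ((f x *ᶻ f y) *ᶻ N (((x - y) ^ k) * s))
          ≡⟨ ∑-comm₁₂ (λ s x y → N (t * s) *ᶻ ((f x *ᶻ f y) *ᶻ N (((x - y) ^ k) * s))) ⟩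
        ∑[ x ] ∑[ y ] ∑[ s ] N (t * s) *ᶻ ((f x *ᶻ f y) *ᶻ N (((x - y) ^ k) * s))
          ≡⟨ ∑-cong (λ x → ∑-cong λ y → trans
               (∑-cong λ s → rearrange (N (t * s)) (f x) (f y) (N (((x - y) ^ k) * s)))
               (sym (trans (cong (f x *ᶻ_) (*-∑ (f y) (λ s → N (t * s) *ᶻ N (((x - y) ^ k) * s))))
                           (*-∑ (f x) (λ s → f y *ᶻ (N (t * s) *ᶻ N (((x - y) ^ k) * s))))))) ⟩
        ∑[ x ] ∑[ y ] f x *ᶻ (f y *ᶻ V t ((x - y) ^ k))
          ≤⟨ ∑-mono (λ x → ∑-mono λ y → *-monoˡ (0≤f x)
               (ℤ.≤-trans (*-monoʳ (V-nonNeg t _) (f≤1 y)) (ℤ.≤-reflexive (ℤ.*-identityˡ _)))) ⟩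
        ∑[ x ] ∑[ y ] f x *ᶻ V t ((x - y) ^ k)
          ≡⟨ ∑-cong (λ x → *-∑ (f x) (λ y → V t ((x - y) ^ k))) ⟨
        ∑[ x ] f x *ᶻ (∑[ y ] V t ((x - y) ^ k))
          ≤⟨ ∑-mono (λ x → *-monoˡ (0≤f x) (powers x)) ⟩
        ∑[ x ] f x *ᶻ bound
          ≡⟨ ∑-* f bound ⟨
        ∣f∣ *ᶻ bound ∎
        where
        open ℤ.≤-Reasoning
        rearrange : ∀ a b c d → a *ᶻ ((b *ᶻ c) *ᶻ d) ≡ b *ᶻ (c *ᶻ (a *ᶻ d))
        rearrange = solve-∀
        powers : ∀ x → ∑[ y ] V t ((x - y) ^ k) ≤ᶻ bound
        powers x = begin
          ∑[ y ] V t ((x - y) ^ k)     ≡⟨ ∑-reflect x (λ d → V t (d ^ k)) ⟩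
          ∑[ d ] V t (d ^ k)           ≤⟨ ∑-fibre-bound (suc m) (poly-^ k) 1≢0 (V t) (V-nonNeg t) ⟩
          + k *ᶻ (∑[ u ] V t u)        ≡⟨ cong (+ k *ᶻ_) (∑-V t) ⟩
          bound                        ∎

      -- Only one factor D is expanded; each of its pairs (x, y) then contributes the sum of `∑-N*D`
      -- at t = (x - y)^k.
      ∑-D² : ∑[ s ] D s *ᶻ D s ≤ᶻ (∣f∣ *ᶻ ∣f∣) *ᶻ (∣f∣ *ᶻ bound)
      ∑-D² = begin
        ∑[ s ] D s *ᶻ D s
          ≡⟨ ∑-cong (λ s → ∑∑-* (λ x y → (f x *ᶻ f y) *ᶻ N (((x - y) ^ k) * s)) (D s)) ⟩
        ∑[ s ] ∑[ x ] ∑[ y ] ((f x *ᶻ f y) *ᶻ N (((x - y) ^ k) * s)) *ᶻ D s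
          ≡⟨ ∑-comm₁₂ (λ s x y → ((f x *ᶻ f y) *ᶻ N (((x - y) ^ k) * s)) *ᶻ D s) ⟩
        ∑[ x ] ∑[ y ] ∑[ s ] ((f x *ᶻ f y) *ᶻ N (((x - y) ^ k) * s)) *ᶻ D s
          ≡⟨ ∑-cong (λ x → ∑-cong λ y → trans
               (∑-cong λ s → ℤ.*-assoc (f x *ᶻ f y) (N (((x - y) ^ k) * s)) (D s))
               (sym (*-∑ (f x *ᶻ f y) (λ s → N (((x - y) ^ k) * s) *ᶻ D s)))) ⟩
        ∑[ x ] ∑[ y ] (f x *ᶻ f y) *ᶻ (∑[ s ] N (((x - y) ^ k) * s) *ᶻ D s)
          ≤⟨ ∑-mono (λ x → ∑-mono λ y → *-monoˡ (*-nonNeg (0≤f x) (0≤f y)) (∑-N*D ((x - y) ^ k))) ⟩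
        ∑[ x ] ∑[ y ] (f x *ᶻ f y) *ᶻ (∣f∣ *ᶻ bound)
          ≡⟨ ∑∑-* (λ x y → f x *ᶻ f y) (∣f∣ *ᶻ bound) ⟨
        (∑[ x ] ∑[ y ] f x *ᶻ f y) *ᶻ (∣f∣ *ᶻ bound)
          ≡⟨ cong (_*ᶻ (∣f∣ *ᶻ bound)) (∑-*-∑ f f) ⟨
        (∣f∣ *ᶻ ∣f∣) *ᶻ (∣f∣ *ᶻ bound) ∎
        where open ℤ.≤-Reasoning

      G : Fin q → Fin q → ℤ
      G y w = ∑[ x ] f x *ᶻ h (w - ((x - y) ^ k))

      S : ℤ
      S = ∑[ y ] ∑[ w ] G y w *ᶻ G y w

      -- Substituting d v for v pulls out d^k by homogeneity. At d = 0 this is no permutation, but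
      -- there both arguments of N are zero for every v.
      ∑-N-powers : ∀ d → ∑[ v ] N ((v ^ k) - ((v - d) ^ k)) ≡ ∑[ v ] N ((d ^ k) * σ k v)
      ∑-N-powers d with d Fin.≟ 0#
      ... | yes refl = ∑-cong λ v → cong N (trans
        (trans (cong (λ x → (v ^ k) - (x ^ k)) (solve 1 (λ v → v :- con (+ 0) := v) refl v))
               (-‿inverseʳ (v ^ k)))
        (sym (trans (cong (_* σ k v) (zeroˡ (0# ^ suc m))) (zeroˡ (σ k v)))))
      ... | no d≢0 = begin
        ∑[ v ] N ((v ^ k) - ((v - d) ^ k))
          ≡⟨ ∑-scale d≢0 (λ v → N ((v ^ k) - ((v - d) ^ k))) ⟨
        ∑[ v ] N (((d * v) ^ k) - (((d * v) - d) ^ k))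
          ≡⟨ ∑-cong (λ v → cong N (homogeneous v)) ⟩
        ∑[ v ] N ((d ^ k) * σ k v) ∎
        where
        open ≡-Reasoning
        homogeneous : ∀ v → ((d * v) ^ k) - (((d * v) - d) ^ k) ≡ (d ^ k) * σ k v
        homogeneous v = begin
          ((d * v) ^ k) - (((d * v) - d) ^ k)
            ≡⟨ cong (λ x → ((d * v) ^ k) - (x ^ k)) (solve 2 (λ d v → (d :* v) :- d := d :* (v :- con (+ 1))) refl d v) ⟩
          ((d * v) ^ k) - ((d * (v - 1#)) ^ k)
            ≡⟨ cong₂ _-_ (^-distrib-* d v k) (^-distrib-* d (v - 1#) k) ⟩
          ((d ^ k) * (v ^ k)) - ((d ^ k) * ((v - 1#) ^ k))
            ≡⟨ solve 3 (λ a b c → (a :* b) :- (a :* c) := a :* (b :- c)) refl (d ^ k) (v ^ k) ((v - 1#) ^ k) ⟩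
          (d ^ k) * σ k v ∎

      -- Once y is replaced by v, the value `σ k v` no longer involves the pair (x, x′), so the sum
      -- over v can be moved outside the pairs.
      S≡∑D : S ≡ ∑[ v ] D (σ k v)
      S≡∑D = begin
        ∑[ y ] ∑[ w ] G y w *ᶻ G y w
          ≡⟨ ∑-cong (λ y → trans (∑-cong λ w → ∑-*-∑ (g y w) (g y w)) (∑-comm₁₂ λ w x x′ → g y w x *ᶻ g y w x′)) ⟩
        ∑[ y ] ∑[ x ] ∑[ x′ ] ∑[ w ] g y w x *ᶻ g y w x′
          ≡⟨ ∑-cong (λ y → ∑-cong λ x → ∑-cong λ x′ → translates y x x′) ⟩
        ∑[ y ] ∑[ x ] ∑[ x′ ] (f x *ᶻ f x′) *ᶻ N (((x - y) ^ k) - ((x′ - y) ^ k))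
          ≡⟨ ∑-comm₁₂ (λ y x x′ → (f x *ᶻ f x′) *ᶻ N (((x - y) ^ k) - ((x′ - y) ^ k))) ⟩
        ∑[ x ] ∑[ x′ ] ∑[ y ] (f x *ᶻ f x′) *ᶻ N (((x - y) ^ k) - ((x′ - y) ^ k))
          ≡⟨ ∑-cong (λ x → ∑-cong λ x′ → differences x x′) ⟩
        ∑[ x ] ∑[ x′ ] ∑[ v ] (f x *ᶻ f x′) *ᶻ N (((x - x′) ^ k) * σ k v)
          ≡⟨ ∑-comm₁₂ (λ v x x′ → (f x *ᶻ f x′) *ᶻ N (((x - x′) ^ k) * σ k v)) ⟨
        ∑[ v ] D (σ k v) ∎
        where
        open ≡-Reasoning
        g : Fin q → Fin q → Fin q → ℤ
        g y w x = f x *ᶻ h (w - ((x - y) ^ k))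
        interchange : ∀ a b c d → (a *ᶻ b) *ᶻ (c *ᶻ d) ≡ (a *ᶻ c) *ᶻ (b *ᶻ d)
        interchange = solve-∀
        translates : ∀ y x x′ → ∑[ w ] g y w x *ᶻ g y w x′ ≡
                     (f x *ᶻ f x′) *ᶻ N (((x - y) ^ k) - ((x′ - y) ^ k))
        translates y x x′ = begin
          ∑[ w ] g y w x *ᶻ g y w x′
            ≡⟨ ∑-cong (λ w → interchange (f x) (h (w - a)) (f x′) (h (w - b))) ⟩
          ∑[ w ] (f x *ᶻ f x′) *ᶻ (h (w - a) *ᶻ h (w - b))
            ≡⟨ *-∑ (f x *ᶻ f x′) (λ w → h (w - a) *ᶻ h (w - b)) ⟨
          (f x *ᶻ f x′) *ᶻ (∑[ w ] h (w - a) *ᶻ h (w - b))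
            ≡⟨ cong ((f x *ᶻ f x′) *ᶻ_) (trans (∑-translates (- a) (- b))
                 (cong N (solve 2 (λ a b → (:- b) :- (:- a) := a :- b) refl a b))) ⟩
          (f x *ᶻ f x′) *ᶻ N (a - b) ∎
          where
          a b : Fin q
          a = (x - y) ^ k
          b = (x′ - y) ^ k
        differences : ∀ x x′ → ∑[ y ] (f x *ᶻ f x′) *ᶻ N (((x - y) ^ k) - ((x′ - y) ^ k)) ≡
                      ∑[ v ] (f x *ᶻ f x′) *ᶻ N (((x - x′) ^ k) * σ k v)
        differences x x′ = begin
          ∑[ y ] (f x *ᶻ f x′) *ᶻ N (((x - y) ^ k) - ((x′ - y) ^ k))
            ≡⟨ *-∑ (f x *ᶻ f x′) (λ y → N (((x - y) ^ k) - ((x′ - y) ^ k))) ⟨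
          (f x *ᶻ f x′) *ᶻ (∑[ y ] N (((x - y) ^ k) - ((x′ - y) ^ k)))
            ≡⟨ cong ((f x *ᶻ f x′) *ᶻ_) (trans (trans
                 (∑-cong λ y → cong (λ a → N (((x - y) ^ k) - (a ^ k)))
                   (solve 3 (λ x x′ y → x′ :- y := (x :- y) :- (x :- x′)) refl x x′ y))
                 (∑-reflect x (λ v → N ((v ^ k) - ((v - (x - x′)) ^ k)))))
                 (∑-N-powers (x - x′))) ⟩
          (f x *ᶻ f x′) *ᶻ (∑[ v ] N (((x - x′) ^ k) * σ k v))
            ≡⟨ *-∑ (f x *ᶻ f x′) (λ v → N (((x - x′) ^ k) * σ k v)) ⟩
          ∑[ v ] (f x *ᶻ f x′) *ᶻ N (((x - x′) ^ k) * σ k v) ∎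

      S²-bound : S *ᶻ S ≤ᶻ + q *ᶻ (+ k *ᶻ ((∣f∣ *ᶻ ∣f∣) *ᶻ (∣f∣ *ᶻ bound)))
      S²-bound = begin
        S *ᶻ S                                         ≡⟨ cong₂ _*ᶻ_ S≡∑D S≡∑D ⟩
        (∑[ v ] D (σ k v)) *ᶻ (∑[ v ] D (σ k v))       ≤⟨ ∑²≤n*∑² (λ v → D (σ k v)) ⟩
        + q *ᶻ (∑[ v ] D (σ k v) *ᶻ D (σ k v))         ≤⟨ *-monoˡ {+ q} (+≤+ ℕ.z≤n) fibres ⟩
        + q *ᶻ (+ k *ᶻ (∑[ s ] D s *ᶻ D s))            ≤⟨ *-monoˡ {+ q} (+≤+ ℕ.z≤n) (*-monoˡ {+ k} (+≤+ ℕ.z≤n) ∑-D²) ⟩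
        + q *ᶻ (+ k *ᶻ ((∣f∣ *ᶻ ∣f∣) *ᶻ (∣f∣ *ᶻ bound))) ∎
        where
        open ℤ.≤-Reasoning
        fibres : ∑[ v ] D (σ k v) *ᶻ D (σ k v) ≤ᶻ + k *ᶻ (∑[ s ] D s *ᶻ D s)
        fibres = ℤ.≤-trans
          (∑-fibre-bound m (poly-σ (suc m)) k≢0 (λ s → D s *ᶻ D s) (λ s → square-nonNeg (D s)))
          -- `σ k` has degree k - 1, which is rounded up to k.
          (*-monoʳ (∑-nonNeg λ s → square-nonNeg (D s)) (+≤+ (ℕ.n≤1+n (suc m))))

  module _ (m : ℕ) (k≢0 : suc (suc m) · 1# ≢ 0#) (X Y Z W : Subset q) where

    private
      k : ℕ
      k = suc (suc m)

      x y z w : ℤ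
      x = + ∣ X ∣
      y = + ∣ Y ∣
      z = + ∣ Z ∣
      w = + ∣ W ∣

      h : Fin q → ℤ
      h e = + q *ᶻ χ Z e +ᶻ -ᶻ z

      ∑h≡0 : ∑[ e ] h e ≡ 0ℤ
      ∑h≡0 = begin
        ∑[ e ] h e                                            ≡⟨ ∑-+ (λ e → + q *ᶻ χ Z e) (λ _ → -ᶻ z) ⟩
        ∑[ e ] + q *ᶻ χ Z e +ᶻ ∑[ e ] (λ (_ : Fin q) → -ᶻ z) e ≡⟨ cong₂ _+ᶻ_ (trans (sym (*-∑ (+ q) (χ Z))) (cong (+ q *ᶻ_) (∑-χ Z))) (∑-const q (-ᶻ z)) ⟩
        + q *ᶻ z +ᶻ + q *ᶻ -ᶻ z                               ≡⟨ cancel (+ q) z ⟩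
        0ℤ                                                    ∎
        where
        open ≡-Reasoning
        cancel : ∀ a b → a *ᶻ b +ᶻ a *ᶻ -ᶻ b ≡ 0ℤ
        cancel = solve-∀

    open Autocorrelation h ∑h≡0
    open Energy m k≢0 (χ X) (χ-nonNeg X) (χ≤1 X) using (S; G; S²-bound; bound; N₀)

    private
      -- The sum of the squares of h; since `χ Z` is idempotent, the expanded square is linear in
      -- it.
      N₀≡ : N₀ ≡ + q *ᶻ (+ q *ᶻ z) -ᶻ + q *ᶻ (z *ᶻ z)
      N₀≡ = begin
        ∑[ e ] h e *ᶻ h (e + 0#)
          ≡⟨ ∑-cong (λ e → trans (cong (λ e′ → h e *ᶻ h e′) (+-identityʳ e))
               (trans (expand (+ q) (χ Z e) z) (cong (λ i → + q *ᶻ + q *ᶻ i +ᶻ (-ᶻ (+ 2 *ᶻ (+ q *ᶻ z)) *ᶻ χ Z e +ᶻ z *ᶻ z)) (χ-idem Z e)))) ⟩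
        ∑[ e ] (+ q *ᶻ + q *ᶻ χ Z e +ᶻ (b *ᶻ χ Z e +ᶻ z *ᶻ z))
          ≡⟨ trans (∑-+ (λ e → + q *ᶻ + q *ᶻ χ Z e) (λ e → b *ᶻ χ Z e +ᶻ z *ᶻ z))
               (cong₂ _+ᶻ_ (linear (+ q *ᶻ + q)) (trans (∑-+ (λ e → b *ᶻ χ Z e) (λ _ → z *ᶻ z)) (cong₂ _+ᶻ_ (linear b) (∑-const q (z *ᶻ z))))) ⟩
        + q *ᶻ + q *ᶻ z +ᶻ (b *ᶻ z +ᶻ + q *ᶻ (z *ᶻ z))
          ≡⟨ collect (+ q) z ⟩
        + q *ᶻ (+ q *ᶻ z) -ᶻ + q *ᶻ (z *ᶻ z) ∎
        where
        open ≡-Reasoning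
        b : ℤ
        b = -ᶻ (+ 2 *ᶻ (+ q *ᶻ z))
        linear : ∀ a → ∑[ e ] a *ᶻ χ Z e ≡ a *ᶻ z
        linear a = trans (sym (*-∑ a (χ Z))) (cong (a *ᶻ_) (∑-χ Z))
        expand : ∀ q c z → (q *ᶻ c +ᶻ -ᶻ z) *ᶻ (q *ᶻ c +ᶻ -ᶻ z) ≡
                 q *ᶻ q *ᶻ (c *ᶻ c) +ᶻ (-ᶻ (+ 2 *ᶻ (q *ᶻ z)) *ᶻ c +ᶻ z *ᶻ z)
        expand = solve-∀
        collect : ∀ q z → q *ᶻ q *ᶻ z +ᶻ (-ᶻ (+ 2 *ᶻ (q *ᶻ z)) *ᶻ z +ᶻ q *ᶻ (z *ᶻ z)) ≡
                  q *ᶻ (q *ᶻ z) -ᶻ q *ᶻ (z *ᶻ z)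
        collect = solve-∀

      N₀≤ : N₀ ≤ᶻ + q *ᶻ (+ q *ᶻ z)
      N₀≤ = ℤ.≤-trans (ℤ.≤-reflexive N₀≡)
        (ℤ.i≤j⇒i-k≤j (+ q *ᶻ (z *ᶻ z)) {{nonNegative (*-nonNeg {+ q} (+≤+ ℕ.z≤n) (square-nonNeg z))}} ℤ.≤-refl)

      0≤N₀ : 0ℤ ≤ᶻ N₀
      0≤N₀ = subst (0ℤ ≤ᶻ_) (∑-cong λ e → cong (λ e′ → h e *ᶻ h e′) (sym (+-identityʳ e)))
        (∑-nonNeg λ e → square-nonNeg (h e))

      -- On Y × W each a in X evaluates h outside Z, where it is -|Z|. The indicators extend the
      -- inequality to all b and c, so that it can be summed over the whole field.
      mean-bound : (∀ {a b c} → a ∈ X → b ∈ Y → c ∈ W → c - ((a - b) ^ k) ∉ Z) →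
                   ∀ b c → (χ Y b *ᶻ χ W c) *ᶻ ((x *ᶻ z) *ᶻ (x *ᶻ z)) ≤ᶻ G b c *ᶻ G b c
      mean-bound ∉Z b c with b ∈? Y | c ∈? W
      ... | yes b∈Y | yes c∈W = ℤ.≤-reflexive (begin
        (χ Y b *ᶻ χ W c) *ᶻ ((x *ᶻ z) *ᶻ (x *ᶻ z)) ≡⟨ cong₂ (λ i j → (i *ᶻ j) *ᶻ ((x *ᶻ z) *ᶻ (x *ᶻ z))) (χ-∈ b∈Y) (χ-∈ c∈W) ⟩
        1ℤ *ᶻ ((x *ᶻ z) *ᶻ (x *ᶻ z))               ≡⟨ signs x z ⟩
        (x *ᶻ -ᶻ z) *ᶻ (x *ᶻ -ᶻ z)                 ≡⟨ cong₂ _*ᶻ_ G≡ G≡ ⟨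
        G b c *ᶻ G b c                             ∎)
        where
        open ≡-Reasoning
        signs : ∀ x z → 1ℤ *ᶻ ((x *ᶻ z) *ᶻ (x *ᶻ z)) ≡ (x *ᶻ -ᶻ z) *ᶻ (x *ᶻ -ᶻ z)
        signs = solve-∀
        term : ∀ a → χ X a *ᶻ h (c - ((a - b) ^ k)) ≡ χ X a *ᶻ -ᶻ z
        term a with a ∈? X
        ... | yes a∈X = cong (χ X a *ᶻ_) (trans (cong (λ i → + q *ᶻ i +ᶻ -ᶻ z) (χ-∉ (∉Z a∈X b∈Y c∈W)))
          (trans (cong (_+ᶻ -ᶻ z) (ℤ.*-zeroʳ (+ q))) (ℤ.+-identityˡ (-ᶻ z))))
        ... | no  a∉X = trans (cong (_*ᶻ h (c - ((a - b) ^ k))) (χ-∉ a∉X))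
          (trans (ℤ.*-zeroˡ (h (c - ((a - b) ^ k)))) (sym (trans (cong (_*ᶻ -ᶻ z) (χ-∉ a∉X)) (ℤ.*-zeroˡ (-ᶻ z)))))
        G≡ : G b c ≡ x *ᶻ -ᶻ z
        G≡ = trans (∑-cong term) (trans (sym (∑-* (χ X) (-ᶻ z))) (cong (_*ᶻ -ᶻ z) (∑-χ X)))
      ... | no b∉Y | _ = ℤ.≤-trans (ℤ.≤-reflexive
        (trans (cong (λ i → (i *ᶻ χ W c) *ᶻ ((x *ᶻ z) *ᶻ (x *ᶻ z))) (χ-∉ b∉Y))
          (trans (cong (_*ᶻ ((x *ᶻ z) *ᶻ (x *ᶻ z))) (ℤ.*-zeroˡ (χ W c))) (ℤ.*-zeroˡ ((x *ᶻ z) *ᶻ (x *ᶻ z))))))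
        (square-nonNeg (G b c))
      ... | yes _ | no c∉W = ℤ.≤-trans (ℤ.≤-reflexive
        (trans (cong (λ i → (χ Y b *ᶻ i) *ᶻ ((x *ᶻ z) *ᶻ (x *ᶻ z))) (χ-∉ c∉W))
          (trans (cong (_*ᶻ ((x *ᶻ z) *ᶻ (x *ᶻ z))) (ℤ.*-zeroʳ (χ Y b))) (ℤ.*-zeroˡ ((x *ᶻ z) *ᶻ (x *ᶻ z))))))
        (square-nonNeg (G b c))

    product-bound : (∀ {a b c} → a ∈ X → b ∈ Y → c ∈ W → c - ((a - b) ^ k) ∉ Z) →
                    (∣ X ∣ ℕ.* ∣ Y ∣ ℕ.* ∣ Z ∣ ℕ.* ∣ W ∣) ℕ.^ 2 ℕ.≤ k ℕ.^ 2 ℕ.* q ℕ.^ 7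
    product-bound ∉Z = cancel ∣ X ∣ ∣ Z ∣ refl refl
      where
      e : ℤ
      e = (y *ᶻ w) *ᶻ ((x *ᶻ z) *ᶻ (x *ᶻ z))

      e≤S : e ≤ᶻ S
      e≤S = begin
        e
          ≡⟨ cong (_*ᶻ ((x *ᶻ z) *ᶻ (x *ᶻ z))) (trans (sym (cong₂ _*ᶻ_ (∑-χ Y) (∑-χ W))) (∑-*-∑ (χ Y) (χ W))) ⟩
        (∑[ b ] ∑[ c ] χ Y b *ᶻ χ W c) *ᶻ ((x *ᶻ z) *ᶻ (x *ᶻ z))
          ≡⟨ ∑∑-* (λ b c → χ Y b *ᶻ χ W c) ((x *ᶻ z) *ᶻ (x *ᶻ z)) ⟩
        ∑[ b ] ∑[ c ] (χ Y b *ᶻ χ W c) *ᶻ ((x *ᶻ z) *ᶻ (x *ᶻ z))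
          ≤⟨ ∑-mono (λ b → ∑-mono λ c → mean-bound ∉Z b c) ⟩
        S ∎
        where open ℤ.≤-Reasoning

      0≤e : 0ℤ ≤ᶻ e
      0≤e = *-nonNeg {y *ᶻ w} (*-nonNeg {y} {w} (+≤+ ℕ.z≤n) (+≤+ ℕ.z≤n)) (square-nonNeg (x *ᶻ z))

      e²-bound : e *ᶻ e ≤ᶻ + q *ᶻ (+ k *ᶻ ((x *ᶻ x) *ᶻ (+ q *ᶻ (+ k *ᶻ (+ q *ᶻ ((+ q *ᶻ (+ q *ᶻ z)) *ᶻ (+ q *ᶻ (+ q *ᶻ z))))))))
      e²-bound = begin
        e *ᶻ e   ≤⟨ square-mono 0≤e e≤S ⟩
        S *ᶻ S   ≤⟨ S²-bound ⟩
        + q *ᶻ (+ k *ᶻ (((∑[ a ] χ X a) *ᶻ (∑[ a ] χ X a)) *ᶻ ((∑[ a ] χ X a) *ᶻ bound)))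
          ≡⟨ cong (λ i → + q *ᶻ (+ k *ᶻ ((i *ᶻ i) *ᶻ (i *ᶻ bound)))) (∑-χ X) ⟩
        + q *ᶻ (+ k *ᶻ ((x *ᶻ x) *ᶻ (x *ᶻ bound)))
          ≤⟨ *-monoˡ {+ q} (+≤+ ℕ.z≤n) (*-monoˡ {+ k} (+≤+ ℕ.z≤n) (*-monoˡ (square-nonNeg x) x*bound≤)) ⟩
        _ ∎
        where
        open ℤ.≤-Reasoning
        bound≤ : bound ≤ᶻ + k *ᶻ (+ q *ᶻ ((+ q *ᶻ (+ q *ᶻ z)) *ᶻ (+ q *ᶻ (+ q *ᶻ z))))
        bound≤ = *-monoˡ {+ k} (+≤+ ℕ.z≤n) (*-monoˡ {+ q} (+≤+ ℕ.z≤n) (square-mono 0≤N₀ N₀≤))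
        -- One of the three factors |X| is given up for q; the other two cancel later and leave the
        -- square of a symmetric product.
        x*bound≤ : x *ᶻ bound ≤ᶻ + q *ᶻ (+ k *ᶻ (+ q *ᶻ ((+ q *ᶻ (+ q *ᶻ z)) *ᶻ (+ q *ᶻ (+ q *ᶻ z)))))
        x*bound≤ = ℤ.≤-trans
          (*-monoʳ (*-nonNeg {+ k} (+≤+ ℕ.z≤n) (*-nonNeg {+ q} (+≤+ ℕ.z≤n) (square-nonNeg N₀))) (+≤+ (∣p∣≤n X)))
          (*-monoˡ {+ q} (+≤+ ℕ.z≤n) bound≤)

      pos-product : (+ (∣ X ∣ ℕ.* ∣ Y ∣ ℕ.* ∣ Z ∣ ℕ.* ∣ W ∣)) ≡ ((x *ᶻ y) *ᶻ z) *ᶻ w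
      pos-product = trans (ℤ.pos-* (∣ X ∣ ℕ.* ∣ Y ∣ ℕ.* ∣ Z ∣) ∣ W ∣) (cong (_*ᶻ w) (trans (ℤ.pos-* (∣ X ∣ ℕ.* ∣ Y ∣) ∣ Z ∣) (cong (_*ᶻ z) (ℤ.pos-* ∣ X ∣ ∣ Y ∣))))

      -- Squaring e ≤ S leaves the surplus factor (|X||Z|)² on both sides. It can be cancelled if X
      -- and Z are nonempty; otherwise the left side of the claim is already zero.
      cancel : ∀ x′ z′ → ∣ X ∣ ≡ x′ → ∣ Z ∣ ≡ z′ →
               (∣ X ∣ ℕ.* ∣ Y ∣ ℕ.* ∣ Z ∣ ℕ.* ∣ W ∣) ℕ.^ 2 ℕ.≤ k ℕ.^ 2 ℕ.* q ℕ.^ 7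
      cancel zero z′ x≡0 _ = subst (λ n → (n ℕ.* ∣ Y ∣ ℕ.* ∣ Z ∣ ℕ.* ∣ W ∣) ℕ.^ 2 ℕ.≤ k ℕ.^ 2 ℕ.* q ℕ.^ 7) (sym x≡0) ℕ.z≤n
      cancel (suc x′) zero _ z≡0 = subst (λ n → (∣ X ∣ ℕ.* ∣ Y ∣ ℕ.* n ℕ.* ∣ W ∣) ℕ.^ 2 ℕ.≤ k ℕ.^ 2 ℕ.* q ℕ.^ 7) (sym z≡0)
        (subst (λ n → (n ℕ.* ∣ W ∣) ℕ.^ 2 ℕ.≤ k ℕ.^ 2 ℕ.* q ℕ.^ 7) (sym (ℕ.*-zeroʳ (∣ X ∣ ℕ.* ∣ Y ∣))) ℕ.z≤n)
      cancel (suc x′) (suc z′) x≡ z≡ = ℤ.drop‿+≤+ (ℤ.*-cancelʳ-≤-pos (+ l) (+ r) ((x *ᶻ z) *ᶻ (x *ᶻ z)) {{pos}} (begin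
        + l *ᶻ ((x *ᶻ z) *ᶻ (x *ᶻ z))
          ≡⟨ cong (_*ᶻ ((x *ᶻ z) *ᶻ (x *ᶻ z))) (trans (pos-^2 (∣ X ∣ ℕ.* ∣ Y ∣ ℕ.* ∣ Z ∣ ℕ.* ∣ W ∣)) (cong₂ _*ᶻ_ pos-product pos-product)) ⟩
        ((((x *ᶻ y) *ᶻ z) *ᶻ w) *ᶻ (((x *ᶻ y) *ᶻ z) *ᶻ w)) *ᶻ ((x *ᶻ z) *ᶻ (x *ᶻ z))
          ≡⟨ lhs x y z w ⟩
        e *ᶻ e
          ≤⟨ e²-bound ⟩
        + q *ᶻ (+ k *ᶻ ((x *ᶻ x) *ᶻ (+ q *ᶻ (+ k *ᶻ (+ q *ᶻ ((+ q *ᶻ (+ q *ᶻ z)) *ᶻ (+ q *ᶻ (+ q *ᶻ z))))))))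
          ≡⟨ rhs (+ q) (+ k) x z ⟩
        ((+ k *ᶻ + k) *ᶻ q⁷) *ᶻ ((x *ᶻ z) *ᶻ (x *ᶻ z))
          ≡⟨ cong (_*ᶻ ((x *ᶻ z) *ᶻ (x *ᶻ z))) (trans (ℤ.pos-* (k ℕ.^ 2) (q ℕ.^ 7)) (cong₂ _*ᶻ_ (pos-^2 k) (pos-^ 7))) ⟨
        + r *ᶻ ((x *ᶻ z) *ᶻ (x *ᶻ z)) ∎))
        where
        open ℤ.≤-Reasoning
        l r : ℕ
        l = (∣ X ∣ ℕ.* ∣ Y ∣ ℕ.* ∣ Z ∣ ℕ.* ∣ W ∣) ℕ.^ 2
        r = k ℕ.^ 2 ℕ.* q ℕ.^ 7
        power : ℕ → ℤ
        power zero    = 1ℤ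
        power (suc n) = + q *ᶻ power n
        q⁷ : ℤ
        q⁷ = power 7
        pos-^ : ∀ n → + (q ℕ.^ n) ≡ power n
        pos-^ zero    = refl
        pos-^ (suc n) = trans (ℤ.pos-* q (q ℕ.^ n)) (cong (+ q *ᶻ_) (pos-^ n))
        pos-^2 : ∀ n → + (n ℕ.^ 2) ≡ + n *ᶻ + n
        pos-^2 n = trans (cong (λ i → + (n ℕ.* i)) (ℕ.*-identityʳ n)) (ℤ.pos-* n n)
        pos : Positive ((x *ᶻ z) *ᶻ (x *ᶻ z))
        pos = subst₂ (λ i j → Positive ((+ i *ᶻ + j) *ᶻ (+ i *ᶻ + j))) (sym x≡) (sym z≡) _
        lhs : ∀ x y z w → ((((x *ᶻ y) *ᶻ z) *ᶻ w) *ᶻ (((x *ᶻ y) *ᶻ z) *ᶻ w)) *ᶻ ((x *ᶻ z) *ᶻ (x *ᶻ z)) ≡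
              ((y *ᶻ w) *ᶻ ((x *ᶻ z) *ᶻ (x *ᶻ z))) *ᶻ ((y *ᶻ w) *ᶻ ((x *ᶻ z) *ᶻ (x *ᶻ z)))
        lhs = solve-∀
        rhs : ∀ q k x z → q *ᶻ (k *ᶻ ((x *ᶻ x) *ᶻ (q *ᶻ (k *ᶻ (q *ᶻ ((q *ᶻ (q *ᶻ z)) *ᶻ (q *ᶻ (q *ᶻ z)))))))) ≡
              ((k *ᶻ k) *ᶻ (q *ᶻ (q *ᶻ (q *ᶻ (q *ᶻ (q *ᶻ (q *ᶻ (q *ᶻ 1ℤ)))))))) *ᶻ ((x *ᶻ z) *ᶻ (x *ᶻ z))
        rhs = solve-∀

-- The image of k in a field of p^n elements.

module Characteristic {q} {_+_ _*_ : Op₂ (Fin q)} { -_ : Op₁ (Fin q)} {0# 1# : Fin q}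
                      (isField : IsField _+_ _*_ -_ 0# 1#) where
  open IsField isField
  open FieldTheory isField
  import Algebra.Properties.CommutativeMonoid.Sum +-commutativeMonoid as Sum

  -- Translation by 1 permutes the field, so it preserves the sum of all elements.
  q·1≡0 : q · 1# ≡ 0#
  q·1≡0 = begin
    q · 1#                                   ≡⟨ solve 2 (λ a b → b := (a :+ b) :- a) refl total (q · 1#) ⟩
    (total + (q · 1#)) - total               ≡⟨ cong (_- total) (cong (λ x → total + x) (Sum.sum-replicate q)) ⟨
    (total + Sum.sum (λ (_ : Fin q) → 1#)) - total ≡⟨ cong (_- total) (Sum.∑-distrib-+ (λ x → x) (λ _ → 1#)) ⟨
    Sum.sum (λ x → x + 1#) - total           ≡⟨ cong (_- total) (Sum.sum-permute (λ x → x) translation) ⟨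
    total - total                            ≡⟨ -‿inverseʳ total ⟩
    0#                                       ∎
    where
    open ≡-Reasoning
    total : Fin q
    total = Sum.sum {q} (λ x → x)
    translation : Permutation q q
    translation = permutation (_+ 1#) (_- 1#)
      (λ x → solve 2 (λ x a → (x :- a) :+ a := x) refl x 1#)
      (λ x → solve 2 (λ x a → (x :+ a) :- a := x) refl x 1#)

  p^n·1≡0⇒p·1≡0 : ∀ p n → (p ℕ.^ n) · 1# ≡ 0# → p · 1# ≡ 0#
  p^n·1≡0⇒p·1≡0 p zero    1·1≡0 = contradiction (trans (sym (+-identityʳ 1#)) 1·1≡0) 1≢0
  p^n·1≡0⇒p·1≡0 p (suc n) eq with (p · 1#) Fin.≟ 0#
  ... | yes p·1≡0 = p·1≡0
  ... | no  p·1≢0 = p^n·1≡0⇒p·1≡0 p n (x*y≡0⇒y≡0 p·1≢0 (trans (sym (×1-homo-* p (p ℕ.^ n))) eq))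

  module _ {p n} (p-prime : Prime p) (q≡p^n : q ≡ p ℕ.^ n) where

    private
      p·1≡0 : p · 1# ≡ 0#
      p·1≡0 = p^n·1≡0⇒p·1≡0 p n (subst (λ m → m · 1# ≡ 0#) q≡p^n q·1≡0)

      multiple : ∀ x {m} → m · 1# ≡ 0# → (x ℕ.* m) · 1# ≡ 0#
      multiple x {m} m·1≡0 = trans (×1-homo-* x m) (trans (cong ((x · 1#) *_) m·1≡0) (zeroʳ (x · 1#)))

      1+multiple≢multiple : ∀ {x y} → x · 1# ≡ 0# → y · 1# ≡ 0# → suc y ≢ x
      1+multiple≢multiple x≡0 y≡0 refl = 1≢0 (trans (sym (+-identityʳ 1#)) (trans (cong (λ x → 1# + x) (sym y≡0)) x≡0))

    -- As k and p are coprime, Bézout yields multiples of k and of p that differ by 1. If k vanished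
    -- in the field, both multiples would, and so would 1.
    k·1≢0 : ∀ k → .{{ℕ.NonZero k}} → k ℕ.< p → k · 1# ≢ 0#
    k·1≢0 k k<p k·1≡0 with coprime-Bézout (prime⇒coprime p-prime k<p)
    ... | Bézout.+- x y eq = 1+multiple≢multiple (multiple x p·1≡0) (multiple y k·1≡0) eq
    ... | Bézout.-+ x y eq = 1+multiple≢multiple (multiple y k·1≡0) (multiple x p·1≡0) eq

-- Transport of a finite Heyting field to its indices.

module Enumerated {a ℓ₁ ℓ₂} {q} (𝔽 : FiniteField a ℓ₁ ℓ₂ q) where
  open FiniteField 𝔽 using (heytingField; enumeration; element; index; commutativeRing; semiring;
                            _^F_; _-F_; SubsetF; image; isValue?; P)
  open HeytingField heytingField using (#⇒invertible; tight; invertible⇒#; #-irrefl)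
  open CommutativeRing commutativeRing
    using (_≈_; ring; rawRing)
    renaming (_+_ to _+F_; _*_ to _*F_; -_ to -F_; 0# to 0F; 1# to 1F;
              refl to ≈-refl; sym to ≈-sym; trans to ≈-trans; isCommutativeRing to F-isCommutativeRing;
              +-cong to +F-cong; +-congˡ to +F-congˡ; +-identityʳ to +F-identityʳ;
              *-cong to *F-cong; *-congˡ to *F-congˡ; *-congʳ to *F-congʳ)
  open import Algebra.Properties.Ring ring using (-0#≈0#)
  open import Algebra.Properties.Semiring.Exp semiring using (^-congˡ)

  element-index : ∀ x → element (index x) ≈ x
  element-index = Inverse.strictlyInverseˡ enumeration

  index-element : ∀ i → index (element i) ≡ i
  index-element = Inverse.strictlyInverseʳ enumeration

  element-injective : ∀ {i j} → element i ≈ element j → i ≡ j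
  element-injective {i} {j} eq = trans (sym (index-element i))
    (trans (Inverse.from-cong enumeration eq) (index-element j))

  _+_ _*_ : Op₂ (Fin q)
  i + j = index (element i +F element j)
  i * j = index (element i *F element j)

  -_ : Op₁ (Fin q)
  - i = index (-F element i)

  0# 1# : Fin q
  0# = index 0F
  1# = index 1F

  -- The operations on indices are computed in the field and re-indexed, so `element` preserves them
  -- by construction, and the ring laws can be pulled back along it.
  element-isRingMonomorphism : IsRingMonomorphism
    (record { _≈_ = _≡_ ; _+_ = _+_ ; _*_ = _*_ ; -_ = -_ ; 0# = 0# ; 1# = 1# }) rawRing element
  element-isRingMonomorphism = record
    { isRingHomomorphism = record
      { isSemiringHomomorphism = record
        { isNearSemiringHomomorphism = record
          { +-isMonoidHomomorphism = record
            { isMagmaHomomorphism = record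
              { isRelHomomorphism = record { cong = λ { refl → ≈-refl } }
              ; homo = λ i j → element-index _
              }
            ; ε-homo = element-index _
            }
          ; *-homo = λ i j → element-index _
          }
        ; 1#-homo = element-index _
        }
      ; -‿homo = λ i → element-index _
      }
    ; injective = element-injective
    }

  isField : IsField _+_ _*_ -_ 0# 1#
  isField = record
    { isCommutativeRing = RingMonomorphism.isCommutativeRing element-isRingMonomorphism F-isCommutativeRing
    ; inverse           = inverse
    ; 1≢0               = 1≢0
    }
    where
    -- Apartness from zero provides an inverse of the difference x - 0 rather than of x.
    x-0≈x : ∀ x → x -F 0F ≈ x
    x-0≈x x = ≈-trans (+F-congˡ -0#≈0#) (+F-identityʳ x)

    inverse : ∀ {x} → x ≢ 0# → ∃[ y ] x * y ≡ 1#
    -- Being different from zero does not by itself give apartness, so the inverse is searched for.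
    -- If there is none, x is not apart from zero, and tightness makes it zero.
    inverse {x} x≢0 with Fin.any? (λ y → (x * y) Fin.≟ 1#)
    ... | yes found = found
    ... | no  ∄y = contradiction
      (trans (sym (index-element x)) (Inverse.from-cong enumeration (proj₁ (tight (element x) 0F) not-apart))) x≢0
      where
      not-apart : ¬ HeytingField._#_ heytingField (element x) 0F
      not-apart x#0 with y , _ , xy≈1 ← #⇒invertible x#0 = ∄y (index y , Inverse.from-cong enumeration
        (≈-trans (*F-cong (≈-sym (x-0≈x (element x))) (element-index y)) xy≈1))

    1≢0 : 1# ≢ 0#
    1≢0 1≡0 = #-irrefl 1≈0 (invertible⇒# (1F , ≈-trans (*F-congˡ (x-0≈x 1F)) 1*1≈1 , ≈-trans (*F-congʳ (x-0≈x 1F)) 1*1≈1))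
      where
      1*1≈1 : 1F *F 1F ≈ 1F
      1*1≈1 = CommutativeRing.*-identityˡ commutativeRing 1F
      1≈0 : 1F ≈ 0F
      1≈0 = ≈-trans (≈-sym (element-index 1F)) (≈-trans (Inverse.to-cong enumeration 1≡0) (element-index 0F))

  open FieldTheory isField using (_^_; _-_; solve; _:=_; _:+_; _:-_)

  element-^ : ∀ i n → element (i ^ n) ≈ element i ^F n
  element-^ i zero    = element-index _
  element-^ i (suc n) = ≈-trans (element-index _) (*F-congˡ (element-^ i n))

  element-- : ∀ i j → element (i - j) ≈ element i -F element j
  element-- i j = ≈-trans (element-index _) (+F-congˡ (element-index _))

  index-P : ∀ k i j l → index (P k (element i) (element j) (element l)) ≡ ((i - j) ^ k) + l
  index-P k i j l = Inverse.from-cong enumeration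
    (+F-cong (≈-sym (≈-trans (element-^ (i - j) k) (^-congˡ k (element-- i j)))) ≈-refl)

  -- Otherwise l = (i - j)^k + (l - (i - j)^k) would be a value of the polynomial.
  ∉-image : ∀ k (X Y Z : SubsetF) {i j l} → i ∈ X → j ∈ Y → l ∈ ∁ (image (P k) X Y Z) → l - ((i - j) ^ k) ∉ Z
  ∉-image k X Y Z {i} {j} {l} i∈X j∈Y l∉image z∈Z = x∈∁p⇒x∉p l∉image
    (lookup⇒[]= l _ (trans (lookup∘tabulate (λ w → does (isValue? (P k) X Y Z w)) l) (dec-true (isValue? (P k) X Y Z l)
      (i , j , l - ((i - j) ^ k) , i∈X , j∈Y , z∈Z ,
        trans (solve 2 (λ l d → l := d :+ (l :- d)) refl l ((i - j) ^ k)) (sym (index-P k i j _))))))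

-- The bound for a given finite field and the passage to real constants and exponents.

complement-bound : ∀ {a ℓ₁ ℓ₂ p n} → Prime p → ∀ {k} → 2 ℕ.≤ k → k ℕ.< p →
                   (𝔽 : FiniteField a ℓ₁ ℓ₂ (p ℕ.^ n)) → let open FiniteField 𝔽 in
                   (X Y Z : SubsetF) →
                   (∣ X ∣ ℕ.* ∣ Y ∣ ℕ.* ∣ Z ∣ ℕ.* ∣ ∁ (image (P k) X Y Z) ∣) ℕ.^ 2 ℕ.≤ k ℕ.^ 2 ℕ.* (p ℕ.^ n) ℕ.^ 7
complement-bound {n = n} p-prime {suc (suc m)} (ℕ.s≤s (ℕ.s≤s _)) k<p 𝔽 X Y Z =
  Correlation.product-bound isField m (Characteristic.k·1≢0 isField {n = n} p-prime refl (suc (suc m)) k<p) X Y Z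
    (∁ (image (P (suc (suc m))) X Y Z)) (∉-image (suc (suc m)) X Y Z)
  where
  open Enumerated 𝔽
  open FiniteField 𝔽 using (image; P)

import Data.Rational.Base as ℚ
open ℚ using (0ℚ)
import Data.Rational.Properties as ℚ
open RationalPowers
open import Defs
open import Level using (Level)
open import Data.Nat.Base using (ℕ; _≤_; _<_; _^_; ∣_-_∣)
open import Data.Nat.Primality using (Prime)
open import Data.Integer.Base using (+_)
open import Data.Rational.Base using (_/_; 1ℚ)
open import Data.Product.Base using (∃-syntax; _×_)
open import Data.Fin.Subset using (∣_∣)

corollary1p6 : ∀ {a ℓ₁ ℓ₂ : Level} (ε : ℝ) → 0< ε →
    ∀ (k : ℕ) → 2 ≤ k →
    ∀ (c : ℝ) → 0< c →
    ∃[ C ] (0< C) ×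
    (∀ (p n : ℕ) → Prime p → k < p → 1 ≤ n →
    ∀ (F : FiniteField a ℓ₁ ℓ₂ (p ^ n)) →
    let open FiniteField F in
    ∀ (X Y Z : SubsetF) →
    [ c · (p ^ n) ^ ((+ 8 / 9) ⊕ ε) ]≤ ∣ X ∣ →
    [ c · (p ^ n) ^ ((+ 8 / 9) ⊕ ε) ]≤ ∣ Y ∣ →
    [ c · (p ^ n) ^ ((+ 8 / 9) ⊕ ε) ]≤ ∣ Z ∣ →
    ∣ ∣ image (P k) X Y Z ∣ - p ^ n ∣ ≤[ C · (p ^ n) ^ (1ℚ ⊕ ⊖ ((+ 3 / 1) ⊙ ε)) ])
corollary1p6 ε 0<ε k 2≤k c 0<c = ConstantReal.fromℚ C , 0<C , bound
  where
  -- C must not depend on q, so one rational below c is fixed in advance and used for every field.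
  ρ-data : ∃[ ρ ] 0ℚ ℚ.< ρ × lower c ρ
  ρ-data = lower-open c 0<c
  ρ : ℚ.ℚ
  ρ = proj₁ ρ-data
  0<ρ : 0ℚ ℚ.< ρ
  0<ρ = proj₁ (proj₂ ρ-data)
  instance
    ρ-positive : ℚ.Positive ρ
    ρ-positive = ℚ.positive 0<ρ
    ρ-nonZero : ℚ.NonZero ρ
    ρ-nonZero = ℚ.pos⇒nonZero ρ
  -- The product bound gives |W| ≤ k q^(11/3) / (|X||Y||Z|), and each of the three sizes contributes
  -- a factor ρ to the denominator.
  C : ℚ.ℚ
  C = fromℕ k ℚ.* (ℚ.1/ ρ) ^ℚ 3
  0<C : 0ℚ ℚ.< C
  0<C = *-pos (ℚ.<-≤-trans 0<1 (fromℕ-mono (ℕ.≤-trans (ℕ.n≤1+n 1) 2≤k)))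
    (^-pos 3 (ℚ.positive⁻¹ (ℚ.1/ ρ) {{ℚ.1/pos⇒pos ρ}}))

  bound : ∀ (p n : ℕ) → Prime p → k < p → 1 ≤ n → ∀ (F : FiniteField _ _ _ (p ^ n)) → let open FiniteField F in
    ∀ (X Y Z : SubsetF) →
    [ c · (p ^ n) ^ ((+ 8 / 9) ⊕ ε) ]≤ ∣ X ∣ →
    [ c · (p ^ n) ^ ((+ 8 / 9) ⊕ ε) ]≤ ∣ Y ∣ →
    [ c · (p ^ n) ^ ((+ 8 / 9) ⊕ ε) ]≤ ∣ Z ∣ →
    ∣ ∣ image (P k) X Y Z ∣ - p ^ n ∣ ≤[ ConstantReal.fromℚ C · (p ^ n) ^ (1ℚ ⊕ ⊖ ((+ 3 / 1) ⊙ ε)) ]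
  bound p n p-prime k<p _ F X Y Z X≥ Y≥ Z≥ r s 0<r C<r s> =
    subst (λ m → m ≤ℚ[ r · (p ^ n) ^ s ])
      (sym (trans (ℕ.m≤n⇒∣m-n∣≡n∸m (∣p∣≤n (image (P k) X Y Z))) (sym (∣∁p∣≡n∸∣p∣ (image (P k) X Y Z)))))
      (Comparison.complement-rational-bound {p ^ n} {k} {∣ X ∣} {∣ Y ∣} {∣ Z ∣} {∣ ∁ (image (P k) X Y Z) ∣} 1≤q 0<ρ 0<r (Comparison.clear-cubes 0<ρ C<r)
        (complement-bound {n = n} p-prime 2≤k k<p F X Y Z) s t (s+3partner s)
        (X≥ ρ t 0<ρ ρ<c t<) (Y≥ ρ t 0<ρ ρ<c t<) (Z≥ ρ t 0<ρ ρ<c t<))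
    where
    open FiniteField F using (image; P)
    open RationalExponents using (partner; s+3partner)
    t : ℚ.ℚ
    t = partner s
    ρ<c : lower c ρ
    ρ<c = proj₂ (proj₂ ρ-data)
    -- The cuts of `⊕`, `⊖` and `⊙` turn s > 1 - 3ε by computation into u < ε, which is why
    -- `partner` has its nested negations; what remains is to cancel 8/9.
    t< : lower ((+ 8 / 9) ⊕ ε) t
    t< = subst (lower ε) (trans (sym (ℚ.+-identityˡ u)) (ℚ.+-assoc (ℚ.- (+ 8 / 9)) (+ 8 / 9) u)) s>
      where
      u : ℚ.ℚ
      u = + 1 / 3 ℚ.* (ℚ.- (ℚ.- 1ℚ ℚ.+ s))
    1≤q : 1 ≤ p ^ n
    1≤q = ℕ.m^n>0 p {{prime⇒nonZero p-prime}} n
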